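{- Let $r\ge 1$, $\mathbb A=\{1,\dots,r\}$, and let $t,q$ be indeterminates. Then $$[\mathrm{Ferm}(t,q)\times\mathrm{Bos}(t,q)]_{SF_q}=1,$$ where $[\ \cdot\ ]_{SF_q}$ is the leftmost reduction associated with $SF_q$, and $\mathrm{Ferm}(t,q)$, $\mathrm{Bos}(t,q)$, $SF_q$ are as defined in the context.
   Context: A biword on $\mathbb A$ is a $2\times n$ matrix $\binom{x_1\cdots x_n}{a_1\cdots a_n}$ ($n\ge0$) with entries in $\mathbb A$. The first row is its top word and the second row its bottom word; $n$ is its length. A biword is viewed as a word in biletters $\binom{x_i}{a_i}$, and biwords are multiplied by concatenation; the empty biword is $1$. Let $\mathcal B$ be the set of biwords. Let $K=\mathbb Z[t,t^{ -1},q,q^{ -1}]$ and let $K\langle\langle\mathcal B\rangle\rangle$ be the algebra of formal sums $\sum_\alpha c(\alpha)\alpha$ with $c(\alpha)\in K$. For a word $w=w_1\cdots w_m$, $\mathrm{inv}\,w$ is the number of pairs $i<j$ with $w_i>w_j$, and $\overline w$ is the nondecreasing rearrangement of $w$. For a biword $\alpha=\binom{x_1\cdots x_n}{a_1\cdots a_n}$, $\mathrm{exc}\,\alpha=\#\{i:a_i>x_i\}$. Define $$\mathrm{Bos}(t,q)=\sum_{w\in\mathbb A^*}t^{\mathrm{exc}\binom{\overline w}{w}}q^{\mathrm{inv}\,w}\binom{\overline w}{w}$$ and $$\mathrm{Ferm}(t,q)=\sum_{J\subseteq\mathbb A}(-1)^{|J|}\sum_{\sigma\in\mathfrak S_J}t^{\mathrm{exc}\,\alpha_\sigma}(-q)^{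 -\mathrm{inv}\,\sigma}\alpha_\sigma .$$ Here $J=\{i_1<\dots<i_l\}$, $\alpha_\sigma=\binom{\sigma(i_1)\cdots\sigma(i_l)}{i_1\cdots i_l}$, and $\mathrm{inv}\,\sigma=\mathrm{inv}(\sigma(i_1)\cdots\sigma(i_l))$. The term $J=\emptyset$ contributes $1$. The reduction system $SF_q$ is the set of pairs $(\alpha,E_\alpha)$ given as follows, for all $x>y$ in $\mathbb A$: - $(\binom{xy}{ab},\binom{yx}{ba})$ if $a>b$; - $(\binom{xy}{ab},q\binom{yx}{ba})$ if $a=b$; - $(\binom{xy}{ab},q^2\binom{yx}{ba})$ if $a<b$. A biword is irreducible if none of its factors of consecutive biletters is a first component $\alpha$ of $SF_q$. The leftmost reduction $[\ \cdot\ ]_{SF_q}$ is the $K$-linear map (applied termwise to infinite sums) defined as follows: - $[\beta]=\beta$ for irreducible $\beta$; - otherwise write uniquely $\beta=\beta_1\beta_2\binom{x}{a}\beta_3$ with $\beta_1\beta_2$ irreducible and $\beta_2\binom{x}{a}=\alpha$ a first component, and set $[\beta]=[\beta_1E_\alpha\beta_3]$ (extended linearly). This process terminates. -}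

module Defs where

open import Data.Nat as ℕ using (ℕ; zero; suc)
open import Data.Integer as ℤ using (ℤ; +_; -_)
open import Data.Fin as Fin using (Fin)
open import Data.Fin.Properties as FinP using (≤-decTotalOrder)
open import Data.List using (List; []; _∷_; _++_; map; concatMap; filter; length; foldr; allFin; cartesianProduct)
open import Data.List.Properties using (≡-dec)
open import Data.List.Relation.Unary.AllPairs using (allPairs?)
open import Data.Product using (_×_; _,_; proj₁; proj₂)
open import Data.Maybe using (Maybe; just; nothing)
open import Data.Bool using (Bool; true; false; if_then_else_; _∧_)
open import Relation.Nullary.Decidable using (does)
open import Relation.Binary.PropositionalEquality using (_≡_)
import Data.List.Sort.InsertionSort.Base as InsSort

-- The ring K = ℤ[t, t⁻¹, q, q⁻¹] of Laurent polynomials.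
-- An element is a finite list of monomials  c · t^i · q^j  encoded as
-- (c , i , j); two elements are equal (_≈K_) iff all their
-- coefficients coincide.

Mono : Set
Mono = ℤ × ℤ × ℤ

K : Set
K = List Mono

0K : K
0K = []

1K : K
1K = (+ 1 , + 0 , + 0) ∷ []

mono : ℤ → ℤ → ℤ → K
mono c i j = (c , i , j) ∷ []

_+K_ : K → K → K
_+K_ = _++_

_*K_ : K → K → K
p *K p' = concatMap (λ { (c , i , j) → map (λ { (c' , i' , j') → (c ℤ.* c' , i ℤ.+ i' , j ℤ.+ j') }) p' }) p

sumK : List K → K
sumK = foldr _+K_ 0K

coeff : K → ℤ → ℤ → ℤ
coeff [] i j = + 0
coeff ((c , i' , j') ∷ p) i j =
  (if does (i' ℤ.≟ i) ∧ does (j' ℤ.≟ j) then c else + 0) ℤ.+ coeff p i j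

_≈K_ : K → K → Set
p ≈K p' = ∀ i j → coeff p i j ≡ coeff p' i j

-- Alphabet 𝔸 = {1,…,r}, modelled as Fin r with its usual order.
-- A biletter (x over a) is the pair (x , a): first component = top
-- letter, second component = bottom letter.  A biword is a list of
-- biletters (concatenation = _++_, empty biword = []).

Word : ℕ → Set
Word r = List (Fin r)

Biletter : ℕ → Set
Biletter r = Fin r × Fin r

Biword : ℕ → Set
Biword r = List (Biletter r)

top : ∀ {r} → Biword r → Word r
top = map proj₁

bottom : ∀ {r} → Biword r → Word r
bottom = map proj₂

biword : ∀ {r} → Word r → Word r → Biword r
biword [] _ = []
biword (_ ∷ _) [] = []
biword (x ∷ u) (a ∷ v) = (x , a) ∷ biword u v

inv : ∀ {r} → Word r → ℕ
inv [] = 0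
inv (x ∷ w) = length (filter (λ y → y Fin.<? x) w) ℕ.+ inv w

exc : ∀ {r} → Biword r → ℕ
exc = filterLen
  where
  filterLen : ∀ {r} → Biword r → ℕ
  filterLen [] = 0
  filterLen ((x , a) ∷ α) = (if does (x Fin.<? a) then 1 else 0) ℕ.+ filterLen α

sortW : ∀ {r} → Word r → Word r
sortW {r} = InsSort.sort (≤-decTotalOrder r)

_==W_ : ∀ {r} → Word r → Word r → Bool
u ==W v = does (≡-dec Fin._≟_ u v)

_==B_ : ∀ {r} → Biword r → Biword r → Bool
_==B_ {r} α β = does (≡-dec (λ p p' → Data.Product.Properties.≡-dec Fin._≟_ Fin._≟_ p p') α β)
  where import Data.Product.Properties

-- Formal sums  Σ_α c(α) α  in K⟨⟨ℬ⟩⟩, given by their coefficient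
-- function.

Series : ℕ → Set
Series r = Biword r → K

oneS : ∀ {r} → Series r
oneS [] = 1K
oneS (_ ∷ _) = 0K

splits : ∀ {A : Set} → List A → List (List A × List A)
splits [] = ([] , []) ∷ []
splits (x ∷ xs) = ([] , x ∷ xs) ∷ map (λ { (u , v) → (x ∷ u , v) }) (splits xs)

_×S_ : ∀ {r} → Series r → Series r → Series r
(F ×S G) γ = sumK (map (λ { (α , β) → F α *K G β }) (splits γ))

-- Bos(t,q) = Σ_{w ∈ 𝔸*} t^{exc (w̄ over w)} q^{inv w} (w̄ over w).
-- The map w ↦ (w̄ over w) is injective, so the coefficient of a biword
-- α is  t^{exc α} q^{inv w}  if α = (w̄ over w) with w = bottom α, and 0
-- otherwise.
Bos : ∀ {r} → Series r
Bos α =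
  if top α ==W sortW (bottom α)
  then mono (+ 1) (+ exc α) (+ inv (bottom α))
  else 0K

-- Ferm(t,q) = Σ_{J ⊆ 𝔸} (-1)^{|J|} Σ_{σ ∈ 𝔖_J} t^{exc α_σ} (-q)^{-inv σ} α_σ,
-- α_σ = (σ(i₁)⋯σ(i_l) over i₁⋯i_l).  The map (J,σ) ↦ α_σ is injective
-- and its image is the set of biwords whose bottom word is strictly
-- increasing (it lists J) and whose top word is a rearrangement of the
-- bottom word (it lists σ(J) = J), i.e. sorts to the bottom word.
-- Coefficient: (-1)^{l} (-1)^{inv σ} t^{exc α} q^{-inv σ}.
signℤ : ℕ → ℤ
signℤ zero = + 1
signℤ (suc n) = - signℤ n

Ferm : ∀ {r} → Series r
Ferm α =
  if does (allPairs? Fin._<?_ (bottom α)) ∧ (sortW (top α) ==W bottom α)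
  then mono (signℤ (length α ℕ.+ inv (top α))) (+ exc α) (- (+ inv (top α)))
  else 0K

-- The reduction system SF_q and the leftmost reduction.
-- For x > y: (x y over a b) → c · (y x over b a) with
--   c = 1 if a > b,  q if a = b,  q² if a < b.
-- Here a rewrite produces a power q^k times a single biword; we record
-- the exponent k.

sfWeight : ∀ {r} → Fin r → Fin r → ℕ
sfWeight a b with b Fin.<? a
... | Relation.Nullary.Decidable.yes _ = 0
... | Relation.Nullary.Decidable.no _ with a Fin.≟ b
...   | Relation.Nullary.Decidable.yes _ = 1
...   | Relation.Nullary.Decidable.no _ = 2

step : ∀ {r} → Biword r → Maybe (ℕ × Biword r)
step [] = nothing
step (p ∷ β) = stepFrom p β
  where
  stepFrom : ∀ {r} → Biletter r → Biword r → Maybe (ℕ × Biword r)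
  stepFrom p [] = nothing
  stepFrom (x , a) ((y , b) ∷ β) with y Fin.<? x
  ... | Relation.Nullary.Decidable.yes _ = just (sfWeight a b , (y , b) ∷ (x , a) ∷ β)
  ... | Relation.Nullary.Decidable.no _ with stepFrom (y , b) β
  ...   | nothing = nothing
  ...   | just (k , β') = just (k , (x , a) ∷ β')

reduceFuel : ∀ {r} → ℕ → Biword r → ℕ × Biword r
reduceFuel zero β = (0 , β)
reduceFuel (suc n) β with step β
... | nothing = (0 , β)
... | just (k , β') with reduceFuel n β'
...   | (k' , γ) = (k ℕ.+ k' , γ)

-- [β]_{SF_q} = q^{proj₁ (reduce β)} · proj₂ (reduce β).
-- Each step swaps one adjacent descent of the top word, hence lowers
-- inv(top β) by exactly one; so inv (top β) ≤ |β|² steps suffice and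
-- the fuel is never exhausted before an irreducible biword is reached.
reduce : ∀ {r} → Biword r → ℕ × Biword r
reduce β = reduceFuel (length β ℕ.* length β) β

allBiwords : (r n : ℕ) → List (Biword r)
allBiwords r zero = [] ∷ []
allBiwords r (suc n) =
  concatMap (λ b → map (b ∷_) (allBiwords r n)) (cartesianProduct (allFin r) (allFin r))

-- Leftmost reduction applied termwise to a formal sum:
--   [ Σ_β c(β) β ] = Σ_β c(β) [β].
-- Since [β] = q^k γ with γ of the same length as β, the coefficient
-- of γ is the finite sum over the biwords β of length |γ| with
-- [β] ∈ K·γ.
reduceS : ∀ {r} → Series r → Series r
reduceS {r} F γ =
  sumK (map (λ β → if proj₂ (reduce β) ==B γ
                   then mono (+ 1) (+ 0) (+ proj₁ (reduce β)) *K F β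
                   else 0K)
            (allBiwords r (length γ)))

{-# OPTIONS --safe #-}
module Submission where

-- A reduction step raises inv(bottom) − inv(top) by exactly the exponent of q it
-- produces.  Hence every pair (α, β) with α in Ferm, β in Bos and αβ reducing to γ
-- contributes the same monomial t^{exc γ} q^{inv(bottom γ)}, up to the sign
-- (-1)^{number of cycles of α}.  Reduction is the stable sort by top letters, so α
-- consists of first biletters of blocks of γ of equal top letter, and α determines β.
-- If γ ≠ 1, the map sending x to the first bottom letter of its block has a cycle κ;
-- the biletters of κ lie all in α or all outside α, and moving them in or out of α is
-- a sign-reversing involution.

open import Defs
open import Data.Nat using (ℕ; _≤_)

open import Data.Bool using (true; false; if_then_else_; _∧_)
open import Data.Fin as Fin using (Fin)
import Data.Fin.Properties as Fin
open import Data.Integer as ℤ using (ℤ; +_; -_)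
import Data.Integer.Properties as ℤ
import Data.Integer.Tactic.RingSolver as ℤSolver
open import Data.List using (List; []; _∷_; _++_; [_]; map; concatMap; filter; length; foldr; allFin; cartesianProduct; cartesianProductWith)
open import Data.List.Membership.Propositional using (_∈_; _∉_; find)
open import Data.List.Membership.Propositional.Properties using (∈-++⁺ˡ; ∈-++⁺ʳ; ∈-∃++; ∈-map⁺; ∈-map⁻; ∈-filter⁺; ∈-filter⁻; ∈-concat⁺′; ∈-cartesianProduct⁺; ∈-cartesianProductWith⁺; ∈-allFin)
open import Data.List.Membership.Propositional.Properties.WithK using (unique∧set⇒bag)
open import Data.List.Properties using (≡-dec; ∷-injective; ∷-injectiveˡ; ∷-injectiveʳ; ++-assoc; ++-identityʳ; ++-cancelˡ; length-++; length-map; map-++; map-∘; map-cong; map-cong-local; filter-++; filter-accept; filter-reject; filter-none; length-filter; length-tabulate)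
open import Data.List.Relation.Binary.BagAndSetEquality using (∼bag⇒↭)
open import Data.List.Relation.Binary.Disjoint.Propositional using (Disjoint)
open import Data.List.Relation.Binary.Permutation.Propositional using (_↭_; prep; swap; ↭-refl; ↭-sym; ↭-trans; ↭⇒↭ₛ)
open import Data.List.Relation.Binary.Permutation.Propositional.Properties using (All-resp-↭; ∈-resp-↭; ↭-length; ++⁺; ++⁺ʳ; drop-∷; filter-↭; ¬x∷xs↭[]; ∷↭∷ʳ) renaming (map⁺ to map-↭)
import Data.List.Relation.Binary.Permutation.Propositional as Perm
import Data.List.Relation.Binary.Permutation.Setoid.Properties as PermSetoid
open import Data.List.Relation.Unary.All as All using (All; []; _∷_)
import Data.List.Relation.Unary.All.Properties as All
open import Data.List.Relation.Unary.AllPairs as AllPairs using (AllPairs; []; _∷_; allPairs?)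
import Data.List.Relation.Unary.AllPairs.Properties as AllPairs
open import Data.List.Relation.Unary.Any using (any?; here; there)
open import Data.List.Relation.Unary.Linked using (Linked; []; [-]; _∷_)
open import Data.List.Relation.Unary.Linked.Properties using (Linked⇒AllPairs)
open import Data.List.Relation.Unary.Unique.Propositional using (Unique)
import Data.List.Relation.Unary.Unique.Propositional.Properties as Unique
import Data.List.Sort.InsertionSort.Properties as InsSort
open import Data.Maybe as Maybe using (Maybe; just; nothing)
open import Data.Nat as ℕ using (zero; suc; z≤n)
import Data.Nat.Properties as ℕ
import Data.Nat.Tactic.RingSolver as ℕSolver
open import Data.Product using (_×_; _,_; proj₁; proj₂; ∃; ∃₂)
import Data.Product.Properties as Product
open import Function using (_∘_; _on_)
open import Function.Bundles using (mk⇔)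
open import Level using (0ℓ)
open import Relation.Binary.Core using (Rel)
open import Relation.Binary.Definitions using (Antisymmetric; DecidableEquality; tri<; tri≈; tri>)
open import Relation.Binary.PropositionalEquality using (_≡_; _≢_; refl; sym; trans; cong; cong₂; subst; subst₂; setoid; module ≡-Reasoning)
open import Relation.Nullary using (¬_; Dec; yes; no; does; contradiction)
open import Relation.Nullary.Decidable using (_×-dec_; dec-true; dec-false)
open import Relation.Unary using (Pred)

open ≡-Reasoning

-- The cycle κ is chosen from γ alone, so toggling it never changes which cycle is toggled next. It
-- exists because γ is, up to permutation, a product of two biwords each having the same letters in
-- both rows: the first-letter map therefore sends the top letters of γ to top letters of γ. The
-- same balance makes the weights agree: inversions between α and β are equally many in the two rows
-- and cancel, while the factor q^(-inv σ) of `Ferm` removes the inversions inside `top α`.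
-- Everything is done for one γ and one monomial t^i q^j at a time, so the cancellation is that of a
-- finite sum of integers.

private
  variable
    r : ℕ
    A : Set

-- Lists up to permutation

Unique-resp-↭ : ∀ {xs ys : List A} → xs ↭ ys → Unique xs → Unique ys
Unique-resp-↭ p = PermSetoid.Unique-resp-↭ (setoid _) (↭⇒↭ₛ p)

++-cancelˡ-↭ : ∀ (xs : List A) {ys zs} → xs ++ ys ↭ xs ++ zs → ys ↭ zs
++-cancelˡ-↭ []       p = p
++-cancelˡ-↭ (x ∷ xs) p = ++-cancelˡ-↭ xs (drop-∷ p)

AllPairs-++⁻ˡ : ∀ {R : Rel A 0ℓ} xs {ys} → AllPairs R (xs ++ ys) → AllPairs R xs
AllPairs-++⁻ˡ []       _        = []
AllPairs-++⁻ˡ (x ∷ xs) (h ∷ hs) = All.++⁻ˡ xs h ∷ AllPairs-++⁻ˡ xs hs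

Unique-++⇒Disjoint : ∀ (xs : List A) {ys} → Unique (xs ++ ys) → Disjoint xs ys
Unique-++⇒Disjoint (x ∷ xs) (h ∷ _) (here refl , q) = All.lookup (All.++⁻ʳ xs h) q refl
Unique-++⇒Disjoint (x ∷ xs) (_ ∷ h) (there p , q)   = Unique-++⇒Disjoint xs h (p , q)

-- Each head occurs in the other list, so distinct heads would be related in both directions. For a
-- strict order antisymmetry is vacuous, which is how this also serves increasing bottom words.
AllPairs-↭⇒≡ : ∀ {R : Rel A 0ℓ} → Antisymmetric _≡_ R → ∀ {xs ys} →
  AllPairs R xs → AllPairs R ys → xs ↭ ys → xs ≡ ys
AllPairs-↭⇒≡ as {[]}     {[]}     _ _ _ = refl
AllPairs-↭⇒≡ as {[]}     {_ ∷ _}  _ _ p = contradiction (↭-sym p) ¬x∷xs↭[]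
AllPairs-↭⇒≡ as {_ ∷ _}  {[]}     _ _ p = contradiction p ¬x∷xs↭[]
AllPairs-↭⇒≡ {A = A} {R} as {x ∷ xs} {y ∷ ys} (hx ∷ hxs) (hy ∷ hys) p =
  tails (heads (∈-resp-↭ p (here refl)) (∈-resp-↭ (↭-sym p) (here refl)))
  where
  heads : x ∈ y ∷ ys → y ∈ x ∷ xs → x ≡ y
  heads (here e)  _         = e
  heads (there _) (here e)  = sym e
  heads (there q) (there q') = as (All.lookup hx q') (All.lookup hy q)
  tails : x ≡ y → x ∷ xs ≡ y ∷ ys
  tails refl = cong (x ∷_) (AllPairs-↭⇒≡ as hxs hys (drop-∷ p))

module Removal (_≟_ : DecidableEquality A) where

  remove : A → List A → List A
  remove x []       = []
  remove x (y ∷ ys) with y ≟ x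
  ... | yes _ = ys
  ... | no  _ = y ∷ remove x ys

  infixl 6 _∖_
  _∖_ : List A → List A → List A
  xs ∖ []       = xs
  xs ∖ (y ∷ ys) = remove y xs ∖ ys

  remove-↭ : ∀ {x xs} → x ∈ xs → x ∷ remove x xs ↭ xs
  remove-↭ {x} {y ∷ ys} p with y ≟ x
  ... | yes refl = ↭-refl
  remove-↭ {x} {y ∷ ys} (here refl) | no ¬e = contradiction refl ¬e
  remove-↭ {x} {y ∷ ys} (there p)   | no ¬e = ↭-trans (swap x y ↭-refl) (prep y (remove-↭ p))

  remove-All : ∀ {P : Pred A 0ℓ} x {xs} → All P xs → All P (remove x xs)
  remove-All x []                 = []
  remove-All x (_∷_ {y} py pys) with y ≟ x
  ... | yes _ = pys
  ... | no  _ = py ∷ remove-All x pys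

  remove-AllPairs : ∀ {R : Rel A 0ℓ} x {xs} → AllPairs R xs → AllPairs R (remove x xs)
  remove-AllPairs x []                 = []
  remove-AllPairs x (_∷_ {y} py pys) with y ≟ x
  ... | yes _ = pys
  ... | no  _ = remove-All x py ∷ remove-AllPairs x pys

  ∖-All : ∀ {P : Pred A 0ℓ} {xs} ys → All P xs → All P (xs ∖ ys)
  ∖-All []       h = h
  ∖-All (y ∷ ys) h = ∖-All ys (remove-All y h)

  ∖-AllPairs : ∀ {R : Rel A 0ℓ} {xs} ys → AllPairs R xs → AllPairs R (xs ∖ ys)
  ∖-AllPairs []       h = h
  ∖-AllPairs (y ∷ ys) h = ∖-AllPairs ys (remove-AllPairs y h)

  ∖-↭ : ∀ {xs ys} → Unique ys → All (_∈ xs) ys → ys ++ (xs ∖ ys) ↭ xs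
  ∖-↭ []      []       = ↭-refl
  ∖-↭ {xs} {y ∷ ys} (h ∷ hs) (p ∷ ps) = ↭-trans (prep y (∖-↭ hs (All.tabulate keep))) (remove-↭ p)
    where
    keep : ∀ {z} → z ∈ ys → z ∈ remove y xs
    keep q with ∈-resp-↭ (↭-sym (remove-↭ p)) (All.lookup ps q)
    ... | here refl = contradiction refl (All.lookup h q)
    ... | there q'  = q'

-- Completing `u` by the letters it misses rearranges the whole alphabet. This bound is what stops
-- the search in `∃-cycle`.
Unique-length : ∀ {u : List (Fin r)} → Unique u → length u ≤ r
Unique-length {r} {u} h = subst (length u ≤_) eq (ℕ.m≤m+n _ _)
  where
  open Removal (Fin._≟_ {r})
  eq : length u ℕ.+ length (allFin r ∖ u) ≡ r
  eq = trans (sym (length-++ u))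
    (trans (↭-length (∖-↭ h (All.tabulate (λ {x} _ → ∈-allFin x)))) (length-tabulate (λ x → x)))

-- Inversions

+-exchange : ∀ a b c → a ℕ.+ (b ℕ.+ c) ≡ b ℕ.+ (a ℕ.+ c)
+-exchange = ℕSolver.solve-∀

below : Fin r → Word r → ℕ
below x w = length (filter (λ y → y Fin.<? x) w)

below-++ : ∀ (x : Fin r) u v → below x (u ++ v) ≡ below x u ℕ.+ below x v
below-++ x u v = trans (cong length (filter-++ (λ y → y Fin.<? x) u v)) (length-++ (filter (λ y → y Fin.<? x) u))

below-↭ : ∀ (x : Fin r) {u v} → u ↭ v → below x u ≡ below x v
below-↭ x p = ↭-length (filter-↭ (λ y → y Fin.<? x) p)

cross : Word r → Word r → ℕ
cross []      v = 0
cross (x ∷ u) v = below x v ℕ.+ cross u v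

inv-++ : ∀ (u v : Word r) → inv (u ++ v) ≡ inv u ℕ.+ inv v ℕ.+ cross u v
inv-++ []      v = sym (ℕ.+-identityʳ _)
inv-++ (x ∷ u) v = trans (cong₂ ℕ._+_ (below-++ x u v) (inv-++ u v)) (rearrange (below x u) _ (inv u) _ _)
  where
  rearrange : ∀ a b c d e → a ℕ.+ b ℕ.+ (c ℕ.+ d ℕ.+ e) ≡ a ℕ.+ c ℕ.+ d ℕ.+ (b ℕ.+ e)
  rearrange = ℕSolver.solve-∀

-- Inversions between two factors see only the multisets of their letters. For two circuits the top
-- and bottom rows thus have equal cross terms, which cancel both in the exponent of q and in the
-- sign.
cross-↭ : ∀ {u u' v v' : Word r} → u ↭ u' → v ↭ v' → cross u v ≡ cross u' v'
cross-↭ {u = u} Perm.refl q = right u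
  where
  right : ∀ w → cross w _ ≡ cross w _
  right []      = refl
  right (x ∷ w) = cong₂ ℕ._+_ (below-↭ x q) (right w)
cross-↭ (prep x p)        q = cong₂ ℕ._+_ (below-↭ x q) (cross-↭ p q)
cross-↭ {v' = v'} (swap {ys = ys} x y p) q =
  trans (cong₂ ℕ._+_ (below-↭ x q) (cong₂ ℕ._+_ (below-↭ y q) (cross-↭ p q)))
    (+-exchange (below x v') (below y v') (cross ys v'))
cross-↭ (Perm.trans p p') q = trans (cross-↭ p q) (cross-↭ p' ↭-refl)

inv-sorted : ∀ {w : Word r} → AllPairs Fin._≤_ w → inv w ≡ 0
inv-sorted []       = refl
inv-sorted {w = x ∷ w} (h ∷ hs) =
  cong₂ ℕ._+_ (cong length (filter-none (λ y → y Fin.<? x) (All.map ℕ.≤⇒≯ h))) (inv-sorted hs)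

-- Each reduction step spends one top inversion, and the fuel of `reduce` is the square of the
-- length.
inv≤length² : ∀ (w : Word r) → inv w ≤ length w ℕ.* length w
inv≤length² []      = z≤n
inv≤length² (x ∷ w) = ℕ.≤-trans
  (ℕ.+-mono-≤ (length-filter (λ y → y Fin.<? x) w) (inv≤length² w))
  (ℕ.≤-trans (ℕ.+-monoʳ-≤ (length w) (ℕ.*-monoʳ-≤ (length w) (ℕ.n≤1+n _))) (ℕ.n≤1+n _))

below-< : ∀ {x y : Fin r} w → y Fin.< x → below x (y ∷ w) ≡ suc (below x w)
below-< {x = x} w p = cong length (filter-accept (λ y → y Fin.<? x) p)

below-≮ : ∀ {x y : Fin r} w → ¬ y Fin.< x → below x (y ∷ w) ≡ below x w
below-≮ {x = x} w p = cong length (filter-reject (λ y → y Fin.<? x) p)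

inv-swap-> : ∀ {x y : Fin r} w → y Fin.< x → inv (x ∷ y ∷ w) ≡ suc (inv (y ∷ x ∷ w))
inv-swap-> {x = x} {y} w p = begin
  below x (y ∷ w) ℕ.+ (below y w ℕ.+ inv w)     ≡⟨ cong (ℕ._+ _) (below-< w p) ⟩
  suc (below x w ℕ.+ (below y w ℕ.+ inv w))     ≡⟨ cong suc (+-exchange (below x w) (below y w) (inv w)) ⟩
  suc (below y w ℕ.+ (below x w ℕ.+ inv w))     ≡⟨ cong (λ n → suc (n ℕ.+ _)) (below-≮ w (ℕ.<-asym p)) ⟨
  suc (below y (x ∷ w) ℕ.+ (below x w ℕ.+ inv w)) ∎

-- The reduction

Circuit : Biword r → Set
Circuit α = top α ↭ bottom α

TopSorted : Biword r → Set
TopSorted α = AllPairs Fin._≤_ (top α)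

block : Fin r → Biword r → Biword r
block x = filter (λ p → proj₁ p Fin.≟ x)

infix 4 _⟶[_]_
data _⟶[_]_ {r : ℕ} : Biword r → ℕ → Biword r → Set where
  here  : ∀ {x y a b β} → y Fin.< x → (x , a) ∷ (y , b) ∷ β ⟶[ sfWeight a b ] (y , b) ∷ (x , a) ∷ β
  there : ∀ {p k β β'} → β ⟶[ k ] β' → p ∷ β ⟶[ k ] p ∷ β'

cons : Biletter r → Maybe (ℕ × Biword r) → Maybe (ℕ × Biword r)
cons p = Maybe.map (λ (k , β) → k , p ∷ β)

-- `step` recurses through a local function that is lambda-lifted over the
-- arguments P, B of the enclosing call and cannot be named from outside.
-- Abstracting those arguments in the second `with` makes them independent
-- variables, so that unification defines `descend` as the recursive call.
mutual
  descend : ∀ (P : Biletter r) (B : Biword r) (x a y b : Fin r) (β : Biword r) →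
    ¬ y Fin.< x → Maybe (ℕ × Biword r)
  descend P B x a y b β ¬y<x = _

  step-descend : ∀ (x a y b : Fin r) β → ¬ y Fin.< x →
    ∃ λ ¬y<x → step ((x , a) ∷ (y , b) ∷ β) ≡ descend (x , a) ((y , b) ∷ β) x a y b β ¬y<x
  step-descend x a y b β p with y Fin.<? x
  ... | yes q = contradiction q p
  ... | no ¬q with (x , a) | (y , b) ∷ β
  ...   | P | B = ¬q , refl {x = descend P B x a y b β ¬q}

-- The two sides recurse under different lifted arguments: `P`, `B` on the left, `(y , b)`,
-- `(z , c) ∷ β` on the right. The induction hypothesis is used once for each and brings both to the
-- same `cons`.
descend-step : ∀ (P : Biletter r) B x a y b β (¬y<x : ¬ y Fin.< x) →
  descend P B x a y b β ¬y<x ≡ cons (x , a) (step ((y , b) ∷ β))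
descend-step P B x a y b []            ¬y<x = refl
descend-step P B x a y b ((z , c) ∷ β) ¬y<x with z Fin.<? y
... | yes _  = refl
... | no ¬z<y
  with descend P B y b z c β ¬z<y | descend-step P B y b z c β ¬z<y
     | descend (y , b) ((z , c) ∷ β) y b z c β ¬z<y | descend-step (y , b) ((z , c) ∷ β) y b z c β ¬z<y
...  | m | e | m' | e' with trans e (sym e')
descend-step P B x a y b ((z , c) ∷ β) ¬y<x | no ¬z<y | nothing | e | m' | e' | refl = refl
descend-step P B x a y b ((z , c) ∷ β) ¬y<x | no ¬z<y | just _  | e | m' | e' | refl = refl

data StepView {r : ℕ} (β : Biword r) : Maybe (ℕ × Biword r) → Set where
  irreducible : Linked Fin._≤_ (top β) → StepView β nothing
  reducible   : ∀ {k β'} → β ⟶[ k ] β' → StepView β (just (k , β'))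

stepView : ∀ (β : Biword r) → StepView β (step β)
stepView []       = irreducible []
stepView (_ ∷ []) = irreducible [-]
stepView ((x , a) ∷ (y , b) ∷ β) = split (y Fin.<? x) (stepView ((y , b) ∷ β))
  where
  extend : ¬ y Fin.< x → ∀ {m} → StepView ((y , b) ∷ β) m → StepView ((x , a) ∷ (y , b) ∷ β) (cons (x , a) m)
  extend ¬p (irreducible h) = irreducible (ℕ.≮⇒≥ ¬p ∷ h)
  extend ¬p (reducible s)   = reducible (there s)

  step-> : y Fin.< x → step ((x , a) ∷ (y , b) ∷ β) ≡ just (sfWeight a b , (y , b) ∷ (x , a) ∷ β)
  step-> p with y Fin.<? x
  ... | yes _ = refl
  ... | no ¬p = contradiction p ¬p

  split : Dec (y Fin.< x) → StepView _ (step ((y , b) ∷ β)) → StepView _ (step ((x , a) ∷ (y , b) ∷ β))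
  split (yes p) _ = subst (StepView _) (sym (step-> p)) (reducible (here p))
  split (no ¬p) v with step-descend x a y b β ¬p
  ... | ¬q , e = subst (StepView _) (sym (trans e (descend-step (x , a) ((y , b) ∷ β) x a y b β ¬q))) (extend ¬p v)

-- The effect of one reduction step

⟶-↭ : ∀ {k} {β β' : Biword r} → β ⟶[ k ] β' → β ↭ β'
⟶-↭ (here _)  = swap _ _ ↭-refl
⟶-↭ (there s) = prep _ (⟶-↭ s)

block-accept : ∀ (x a : Fin r) β → block x ((x , a) ∷ β) ≡ (x , a) ∷ block x β
block-accept x a β = filter-accept (λ p → proj₁ p Fin.≟ x) refl

block-reject : ∀ {x z : Fin r} a β → x ≢ z → block z ((x , a) ∷ β) ≡ block z β
block-reject {z = z} a β x≢z = filter-reject (λ p → proj₁ p Fin.≟ z) x≢z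

block-∷⁺ : ∀ z (p : Biletter r) {β β'} → block z β ≡ block z β' → block z (p ∷ β) ≡ block z (p ∷ β')
block-∷⁺ z (x , a) e with x Fin.≟ z
... | yes _ = cong ((x , a) ∷_) e
... | no _  = e

block-∷⁻ : ∀ z (p : Biletter r) {β β'} → block z (p ∷ β) ≡ block z (p ∷ β') → block z β ≡ block z β'
block-∷⁻ z (x , a) e with x Fin.≟ z
... | yes _ = ∷-injectiveʳ e
... | no _  = e

-- A swap needs a strict descent, so its two biletters lie in different blocks and no block notices
-- it. This is the stability of the sort.
⟶-block : ∀ {k} {β β' : Biword r} → β ⟶[ k ] β' → ∀ z → block z β ≡ block z β'
⟶-block (there {p} {β = β} {β'} s) z = block-∷⁺ z p {β} {β'} (⟶-block s z)
⟶-block {β = β₀} {β'₀} (here {x} {y} {a} {b} {β} y<x) z = split (x Fin.≟ z)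
  where
  split : Dec (x ≡ z) → block z β₀ ≡ block z β'₀
  split (no x≢z)   = trans (block-reject a _ x≢z) (block-∷⁺ z (y , b) (sym (block-reject a β x≢z)))
  split (yes refl) = trans (block-∷⁺ z (x , a) (block-reject b β (Fin.<⇒≢ y<x))) (sym (block-reject b _ (Fin.<⇒≢ y<x)))

⟶-inv-top : ∀ {k} {β β' : Biword r} → β ⟶[ k ] β' → inv (top β) ≡ suc (inv (top β'))
⟶-inv-top (here {β = β} y<x) = inv-swap-> (top β) y<x
⟶-inv-top (there {x , _} s)  =
  trans (cong₂ ℕ._+_ (below-↭ x (map-↭ proj₁ (⟶-↭ s))) (⟶-inv-top s)) (ℕ.+-suc _ _)

-- The exponents 0, 1, 2 are one more than the changes -1, 0, 1 in bottom inversions; the extra one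
-- matches the top inversion lost by the same swap.
sfWeight-inv : ∀ (a b : Fin r) w → sfWeight a b ℕ.+ inv (a ∷ b ∷ w) ≡ suc (inv (b ∷ a ∷ w))
sfWeight-inv a b w with b Fin.<? a
... | yes b<a = inv-swap-> w b<a
... | no b≮a with a Fin.≟ b
...   | yes refl = refl
...   | no a≢b   = cong suc (sym (inv-swap-> w (Fin.≤∧≢⇒< (ℕ.≮⇒≥ b≮a) a≢b)))

⟶-inv-bottom : ∀ {k} {β β' : Biword r} → β ⟶[ k ] β' → k ℕ.+ inv (bottom β) ≡ suc (inv (bottom β'))
⟶-inv-bottom (here {a = a} {b} {β} _) = sfWeight-inv a b (bottom β)
⟶-inv-bottom {k = k} (there {_ , a} {β = β} {β'} s) = begin
  k ℕ.+ (below a (bottom β) ℕ.+ inv (bottom β))  ≡⟨ +-exchange k (below a (bottom β)) (inv (bottom β)) ⟩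
  below a (bottom β) ℕ.+ (k ℕ.+ inv (bottom β))  ≡⟨ cong₂ ℕ._+_ (below-↭ a (map-↭ proj₂ (⟶-↭ s))) (⟶-inv-bottom s) ⟩
  below a (bottom β') ℕ.+ suc (inv (bottom β'))  ≡⟨ ℕ.+-suc _ _ ⟩
  suc (below a (bottom β') ℕ.+ inv (bottom β'))  ∎

-- The first three fields make `γ` the stable sort of `β` by top letters. The field `weight` adds up
-- the invariant over all steps, using that the sorted word `top γ` has no inversions.
record Normalises {r : ℕ} (β : Biword r) (k : ℕ) (γ : Biword r) : Set where
  field
    perm      : β ↭ γ
    blocks    : ∀ z → block z β ≡ block z γ
    topSorted : TopSorted γ
    weight    : k ℕ.+ inv (bottom β) ≡ inv (top β) ℕ.+ inv (bottom γ)

irreducible-normalises : ∀ {β : Biword r} → Linked Fin._≤_ (top β) → Normalises β 0 β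
irreducible-normalises {β = β} l = record
  { perm = ↭-refl ; blocks = λ _ → refl ; topSorted = sorted ; weight = cong (ℕ._+ inv (bottom β)) (sym (inv-sorted sorted)) }
  where sorted = Linked⇒AllPairs Fin.≤-trans l

⟶-normalises : ∀ {k k'} {β β' γ : Biword r} → β ⟶[ k ] β' → Normalises β' k' γ → Normalises β (k ℕ.+ k') γ
⟶-normalises {k = k} {k'} {β} {β'} {γ} s n = record
  { perm      = ↭-trans (⟶-↭ s) perm
  ; blocks    = λ z → trans (⟶-block s z) (blocks z)
  ; topSorted = topSorted
  ; weight    = begin
      k ℕ.+ k' ℕ.+ inv (bottom β)             ≡⟨ exchange k k' _ ⟩
      k' ℕ.+ (k ℕ.+ inv (bottom β))           ≡⟨ cong (k' ℕ.+_) (⟶-inv-bottom s) ⟩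
      k' ℕ.+ suc (inv (bottom β'))            ≡⟨ ℕ.+-suc k' _ ⟩
      suc (k' ℕ.+ inv (bottom β'))            ≡⟨ cong suc weight ⟩
      suc (inv (top β')) ℕ.+ inv (bottom γ)   ≡⟨ cong (ℕ._+ inv (bottom γ)) (⟶-inv-top s) ⟨
      inv (top β) ℕ.+ inv (bottom γ)          ∎
  }
  where
  open Normalises n
  exchange : ∀ a b c → a ℕ.+ b ℕ.+ c ≡ b ℕ.+ (a ℕ.+ c)
  exchange = ℕSolver.solve-∀

reduceFuel-normalises : ∀ n (β : Biword r) → inv (top β) ≤ n →
  Normalises β (proj₁ (reduceFuel n β)) (proj₂ (reduceFuel n β))
reduceFuel-normalises zero    β h with step β | stepView β
... | _ | irreducible l = irreducible-normalises l
... | _ | reducible s   = contradiction (subst (_≤ 0) (⟶-inv-top s) h) λ ()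
reduceFuel-normalises (suc n) β h with step β | stepView β
... | _ | irreducible l = irreducible-normalises l
... | _ | reducible {β' = β'} s =
  ⟶-normalises s (reduceFuel-normalises n β' (ℕ.≤-pred (subst (_≤ suc n) (⟶-inv-top s) h)))

reduce-normalises : ∀ (β : Biword r) → Normalises β (proj₁ (reduce β)) (proj₂ (reduce β))
reduce-normalises β = reduceFuel-normalises _ β
  (subst (λ n → inv (top β) ≤ n ℕ.* n) (length-map proj₁ β) (inv≤length² (top β)))

-- Equal blocks force the same top letters to occur, sortedness puts the least one first in both
-- biwords, and its block yields the bottom letter. Normal forms can thus be identified without
-- following the rewriting.
blocks-determine : ∀ {γ δ : Biword r} → TopSorted γ → TopSorted δ → (∀ z → block z γ ≡ block z δ) → γ ≡ δ
blocks-determine {γ = []}     {[]}          _ _ _ = refl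
blocks-determine {γ = []}     {(y , b) ∷ δ} _ _ e with () ← trans (e y) (block-accept y b δ)
blocks-determine {γ = (x , a) ∷ γ} {[]}     _ _ e with () ← trans (sym (e x)) (block-accept x a γ)
blocks-determine {γ = (x , a) ∷ γ} {(y , b) ∷ δ} (hx ∷ hγ) (hy ∷ hδ) e =
  tails (Fin.≤-antisym (first hx (member (sym ∘ e))) (first hy (member e)))
  where
  member : ∀ {x a γ δ} → (∀ z → block z ((x , a) ∷ γ) ≡ block z δ) → x ∈ top δ
  member {x} {a} {γ} e = ∈-map⁺ proj₁ (proj₁ (∈-filter⁻ (λ p → proj₁ p Fin.≟ x)
    (subst ((x , a) ∈_) (trans (sym (block-accept x a γ)) (e x)) (here refl))))
  first : ∀ {z w u} → All (z Fin.≤_) u → w ∈ z ∷ u → z Fin.≤ w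
  first h (here refl) = ℕ.≤-refl
  first h (there p)   = All.lookup h p
  tails : x ≡ y → (x , a) ∷ γ ≡ (y , b) ∷ δ
  tails refl with ∷-injectiveˡ (trans (sym (block-accept x a γ)) (trans (e x) (block-accept x b δ)))
  ... | refl = cong (_ ∷_) (blocks-determine hγ hδ (λ z → block-∷⁻ z (x , a) (e z)))

-- Signs

signℤ-+ : ∀ m n → signℤ (m ℕ.+ n) ≡ signℤ m ℤ.* signℤ n
signℤ-+ zero    n = sym (ℤ.*-identityˡ _)
signℤ-+ (suc m) n = trans (cong -_ (signℤ-+ m n)) (ℤ.neg-distribˡ-* (signℤ m) (signℤ n))

signℤ-double : ∀ n → signℤ (n ℕ.+ n) ≡ + 1
signℤ-double zero    = refl
signℤ-double (suc n) = begin
  - signℤ (n ℕ.+ suc n)   ≡⟨ cong (-_ ∘ signℤ) (ℕ.+-suc n n) ⟩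
  - - signℤ (n ℕ.+ n)     ≡⟨ ℤ.neg-involutive _ ⟩
  signℤ (n ℕ.+ n)         ≡⟨ signℤ-double n ⟩
  + 1                     ∎

signℤ-inv-swap : ∀ {x y : Fin r} w → x ≢ y → signℤ (inv (x ∷ y ∷ w)) ≡ - signℤ (inv (y ∷ x ∷ w))
signℤ-inv-swap {x = x} {y} w x≢y with Fin.<-cmp x y
... | tri< x<y _ _ = trans (sym (ℤ.neg-involutive _)) (cong -_ (sym (cong signℤ (inv-swap-> w x<y))))
... | tri≈ _ x≡y _ = contradiction x≡y x≢y
... | tri> _ _ y<x = cong signℤ (inv-swap-> w y<x)

-- For a circuit with distinct letters, (-1)^(number of cycles).
ε : Biword r → ℤ
ε α = signℤ (length α) ℤ.* (signℤ (inv (top α)) ℤ.* signℤ (inv (bottom α)))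

Distinct : Biword r → Set
Distinct α = Unique (top α) × Unique (bottom α)

Distinct-resp-↭ : ∀ {α β : Biword r} → α ↭ β → Distinct α → Distinct β
Distinct-resp-↭ p (t , b) = Unique-resp-↭ (map-↭ proj₁ p) t , Unique-resp-↭ (map-↭ proj₂ p) b

ε-∷ : ∀ x a (α : Biword r) →
  ε ((x , a) ∷ α) ≡ - (signℤ (below x (top α)) ℤ.* signℤ (below a (bottom α))) ℤ.* ε α
ε-∷ x a α = trans
  (cong₂ (λ s t → - signℤ (length α) ℤ.* (s ℤ.* t)) (signℤ-+ (below x (top α)) _) (signℤ-+ (below a (bottom α)) _))
  (rearrange (signℤ (length α)) (signℤ (below x (top α))) (signℤ (inv (top α))) (signℤ (below a (bottom α))) (signℤ (inv (bottom α))))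
  where
  rearrange : ∀ l x t a b → - l ℤ.* ((x ℤ.* t) ℤ.* (a ℤ.* b)) ≡ - (x ℤ.* a) ℤ.* (l ℤ.* (t ℤ.* b))
  rearrange = ℤSolver.solve-∀

ε-prep : ∀ p {α β : Biword r} → α ↭ β → ε α ≡ ε β → ε (p ∷ α) ≡ ε (p ∷ β)
ε-prep (x , a) {α} {β} p e = begin
  ε ((x , a) ∷ α)  ≡⟨ ε-∷ x a α ⟩
  _                ≡⟨ cong₂ ℤ._*_ (cong₂ (λ m n → - (signℤ m ℤ.* signℤ n)) (below-↭ x (map-↭ proj₁ p)) (below-↭ a (map-↭ proj₂ p))) e ⟩
  _                ≡⟨ ε-∷ x a β ⟨
  ε ((x , a) ∷ β)  ∎

ε-swap : ∀ p q (α : Biword r) → Distinct (p ∷ q ∷ α) → ε (p ∷ q ∷ α) ≡ ε (q ∷ p ∷ α)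
ε-swap (x , a) (y , b) α (((x≢y ∷ _) ∷ _) , ((a≢b ∷ _) ∷ _)) = cong (signℤ (length ((x , a) ∷ (y , b) ∷ α)) ℤ.*_)
  (trans (cong₂ ℤ._*_ (signℤ-inv-swap (top α) x≢y) (signℤ-inv-swap (bottom α) a≢b))
    (neg*neg (signℤ (inv (y ∷ x ∷ top α))) (signℤ (inv (b ∷ a ∷ bottom α)))))
  where
  neg*neg : ∀ s t → - s ℤ.* - t ≡ s ℤ.* t
  neg*neg = ℤSolver.solve-∀

-- Exchanging neighbouring biletters with distinct letters flips the parity of inversions in both
-- rows at once. Hence a cycle may be brought to the front of α although `Ferm` fixes the order by
-- bottom letters.
ε-↭ : ∀ {α β : Biword r} → Distinct α → α ↭ β → ε α ≡ ε β
ε-↭ d Perm.refl = refl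
ε-↭ (_ ∷ t , _ ∷ b) (prep p s) = ε-prep p s (ε-↭ (t , b) s)
ε-↭ d@(_ ∷ _ ∷ t , _ ∷ _ ∷ b) (swap p q s) =
  trans (ε-swap p q _ d) (ε-prep q (prep p s) (ε-prep p s (ε-↭ (t , b) s)))
ε-↭ d (Perm.trans s s') = trans (ε-↭ d s) (ε-↭ (Distinct-resp-↭ s d) s')

-- The cross inversions agree in the two rows, so their signs multiply to one.
ε-++ : ∀ (α β : Biword r) → Circuit α → Circuit β → ε (α ++ β) ≡ ε α ℤ.* ε β
ε-++ α β cα cβ = begin
  signℤ (length (α ++ β)) ℤ.* (signℤ (inv (top (α ++ β))) ℤ.* signℤ (inv (bottom (α ++ β))))
    ≡⟨ cong₂ ℤ._*_ (cong signℤ (length-++ α)) (cong₂ (λ u v → signℤ (inv u) ℤ.* signℤ (inv v)) (map-++ proj₁ α β) (map-++ proj₂ α β)) ⟩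
  signℤ (length α ℕ.+ length β) ℤ.* (signℤ (inv (top α ++ top β)) ℤ.* signℤ (inv (bottom α ++ bottom β)))
    ≡⟨ cong₂ ℤ._*_ (signℤ-+ (length α) _) (cong₂ ℤ._*_ (split (top α) (top β)) (trans (split (bottom α) (bottom β)) (cong (λ n → signℤ (inv (bottom α)) ℤ.* signℤ (inv (bottom β)) ℤ.* signℤ n) (sym (cross-↭ cα cβ))))) ⟩
  _ ≡⟨ rearrange (signℤ (length α)) _ (signℤ (inv (top α))) _ (signℤ c) (signℤ (inv (bottom α))) _ ⟩
  ε α ℤ.* ε β ℤ.* (signℤ c ℤ.* signℤ c)
    ≡⟨ cong (ε α ℤ.* ε β ℤ.*_) (trans (sym (signℤ-+ c c)) (signℤ-double c)) ⟩
  ε α ℤ.* ε β ℤ.* + 1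
    ≡⟨ ℤ.*-identityʳ _ ⟩
  ε α ℤ.* ε β ∎
  where
  c = cross (top α) (top β)
  split : ∀ u v → signℤ (inv (u ++ v)) ≡ signℤ (inv u) ℤ.* signℤ (inv v) ℤ.* signℤ (cross u v)
  split u v = trans (cong signℤ (inv-++ u v))
    (trans (signℤ-+ (inv u ℕ.+ inv v) _) (cong (ℤ._* signℤ (cross u v)) (signℤ-+ (inv u) _)))
  rearrange : ∀ l l' t t' c b b' → (l ℤ.* l') ℤ.* ((t ℤ.* t' ℤ.* c) ℤ.* (b ℤ.* b' ℤ.* c)) ≡
    (l ℤ.* (t ℤ.* b)) ℤ.* (l' ℤ.* (t' ℤ.* b')) ℤ.* (c ℤ.* c)
  rearrange = ℤSolver.solve-∀

-- Paths and cycles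

-- The biletter `(x , a)` is read as an arrow from `x` to `a`. The path ends at `a`, and `u` lists
-- its earlier vertices backwards, so that following one more arrow is a `∷`.
edges : Fin r → Word r → Biword r
edges a []      = []
edges a (x ∷ u) = (x , a) ∷ edges x u

top-edges : ∀ (a : Fin r) u → top (edges a u) ≡ u
top-edges a []      = refl
top-edges a (x ∷ u) = cong (x ∷_) (top-edges x u)

bottom-edges : ∀ (a : Fin r) v z → bottom (edges a (v ++ [ z ])) ≡ a ∷ v
bottom-edges a []      z = refl
bottom-edges a (x ∷ v) z = cong (a ∷_) (bottom-edges x v z)

All-edges-++⁻ˡ : ∀ {P : Pred (Biletter r) 0ℓ} {a} u {w} → All P (edges a (u ++ w)) → All P (edges a u)
All-edges-++⁻ˡ []      _        = []
All-edges-++⁻ˡ (x ∷ u) (h ∷ hs) = h ∷ All-edges-++⁻ˡ u hs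

cycle : Fin r → Word r → Biword r
cycle c v = edges c (v ++ [ c ])

cycle-circuit : ∀ (c : Fin r) v → Circuit (cycle c v)
cycle-circuit c v = subst₂ _↭_ (sym (top-edges c _)) (sym (bottom-edges c v c)) (↭-sym (∷↭∷ʳ c v))

-- A letter other than `c` forms an inversion with `c` in exactly one of the two positions of `c`,
-- before or after `v`.
cross+below : ∀ (c : Fin r) v → All (_≢ c) v → cross v [ c ] ℕ.+ below c v ≡ length v
cross+below c []      []       = refl
cross+below c (x ∷ v) (x≢c ∷ h) with ih ← cross+below c v h | Fin.<-cmp x c
... | tri≈ _ x≡c _ = contradiction x≡c x≢c
... | tri< x<c _ c≮x = trans (cong₂ (λ m n → m ℕ.+ cross v [ c ] ℕ.+ n) (below-≮ [] c≮x) (below-< v x<c)) (trans (ℕ.+-suc _ _) (cong suc ih))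
... | tri> x≮c _ c<x = trans (cong₂ (λ m n → m ℕ.+ cross v [ c ] ℕ.+ n) (below-< [] c<x) (below-≮ v x≮c)) (cong suc ih)

-- The rows are `v ++ [ c ]` and `c ∷ v`. Together they have twice `inv v` plus `length v`
-- inversions, and the length of the cycle is `suc (length v)`, so the total is odd.
ε-cycle : ∀ (c : Fin r) v → Unique (v ++ [ c ]) → ε (cycle c v) ≡ - + 1
ε-cycle c v h = begin
  signℤ (length κ) ℤ.* (signℤ (inv (top κ)) ℤ.* signℤ (inv (bottom κ)))
    ≡⟨ cong (signℤ (length κ) ℤ.*_) (signℤ-+ (inv (top κ)) _) ⟨
  signℤ (length κ) ℤ.* signℤ (inv (top κ) ℕ.+ inv (bottom κ))
    ≡⟨ signℤ-+ (length κ) _ ⟨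
  signℤ (length κ ℕ.+ (inv (top κ) ℕ.+ inv (bottom κ)))
    ≡⟨ cong signℤ (cong₂ ℕ._+_ len (cong₂ ℕ._+_ (trans (cong inv (top-edges c (v ++ [ c ]))) (inv-++ v [ c ])) (cong inv (bottom-edges c v c)))) ⟩
  signℤ (suc (length v) ℕ.+ (inv v ℕ.+ 0 ℕ.+ cross v [ c ] ℕ.+ (below c v ℕ.+ inv v)))
    ≡⟨ cong signℤ (rearrange (length v) (inv v) (cross v [ c ]) (below c v)) ⟩
  signℤ (suc (length v ℕ.+ (cross v [ c ] ℕ.+ below c v) ℕ.+ (inv v ℕ.+ inv v)))
    ≡⟨ cong (λ n → signℤ (suc (length v ℕ.+ n ℕ.+ (inv v ℕ.+ inv v)))) (cross+below c v c∉v) ⟩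
  - signℤ (length v ℕ.+ length v ℕ.+ (inv v ℕ.+ inv v))
    ≡⟨ cong -_ (trans (signℤ-+ (length v ℕ.+ length v) _) (cong₂ ℤ._*_ (signℤ-double (length v)) (signℤ-double (inv v)))) ⟩
  - + 1 ∎
  where
  κ = cycle c v
  c∉v : All (_≢ c) v
  c∉v = All.tabulate λ { p refl → Unique-++⇒Disjoint v h (p , here refl) }
  len : length κ ≡ suc (length v)
  len = trans (sym (length-map proj₂ κ)) (cong length (bottom-edges c v c))
  rearrange : ∀ l i x b → suc l ℕ.+ (i ℕ.+ 0 ℕ.+ x ℕ.+ (b ℕ.+ i)) ≡ suc (l ℕ.+ (x ℕ.+ b) ℕ.+ (i ℕ.+ i))
  rearrange = ℕSolver.solve-∀

-- First biletters of the blocks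

_≟B_ : DecidableEquality (Biletter r)
_≟B_ = Product.≡-dec Fin._≟_ Fin._≟_

module _ {r : ℕ} where
  open Removal (_≟B_ {r}) public

-- The graph of the map on top letters whose cycles are toggled: single-valued by `Head-unique`,
-- defined on `top γ` by `∃-Head`.
Head : Biword r → Biletter r → Set
Head γ p = ∃ λ ρ → block (proj₁ p) γ ≡ p ∷ ρ

Head-unique : ∀ {γ : Biword r} {x a b} → Head γ (x , a) → Head γ (x , b) → a ≡ b
Head-unique (_ , e) (_ , e') with refl ← trans (sym e) e' = refl

Head⇒∈ : ∀ {γ : Biword r} {p} → Head γ p → p ∈ γ
Head⇒∈ {p = p} (_ , e) = proj₁ (∈-filter⁻ (λ q → proj₁ q Fin.≟ proj₁ p) (subst (p ∈_) (sym e) (here refl)))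

∃-Head : ∀ {γ : Biword r} {x} → x ∈ top γ → ∃ λ b → Head γ (x , b)
∃-Head {γ = γ} {x} h with ∈-map⁻ proj₁ h
... | p , p∈γ , refl = first (block x γ) refl (∈-filter⁺ (λ q → proj₁ q Fin.≟ x) p∈γ refl)
  where
  first : ∀ β → block x γ ≡ β → p ∈ β → ∃ λ b → Head γ (x , b)
  first ((y , b) ∷ ρ) e _
    with refl ← proj₂ (∈-filter⁻ (λ q → proj₁ q Fin.≟ x) {xs = γ} (subst ((y , b) ∈_) (sym e) (here refl))) = b , ρ , e

block-remove-≢ : ∀ {z} (p : Biletter r) γ → proj₁ p ≢ z → block z (remove p γ) ≡ block z γ
block-remove-≢ p []      h = refl
block-remove-≢ {z = z} p (q ∷ γ) h with q ≟B p
... | yes refl = sym (block-reject (proj₂ q) γ h)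
... | no _     = block-∷⁺ z q (block-remove-≢ p γ h)

block-remove-Head : ∀ {p : Biletter r} γ → Head γ p → p ∷ block (proj₁ p) (remove p γ) ≡ block (proj₁ p) γ
block-remove-Head {p = x , a} ((y , b) ∷ γ) (ρ , e) with (y , b) ≟B (x , a)
... | yes refl = sym (block-accept x a γ)
... | no ¬e    = split (y Fin.≟ x)
  where
  split : Dec (y ≡ x) → (x , a) ∷ block x ((y , b) ∷ remove (x , a) γ) ≡ block x ((y , b) ∷ γ)
  split (yes refl) = contradiction (∷-injectiveˡ (trans (sym (block-accept x b γ)) e)) ¬e
  split (no y≢x)   = trans (cong (_ ∷_) (block-reject b _ y≢x))
    (trans (block-remove-Head γ (ρ , trans (sym (block-reject b γ y≢x)) e)) (sym (block-reject b γ y≢x)))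

-- With distinct top letters each block loses at most one biletter, namely its first, so removing
-- one head leaves the others heads, and placing α in front restores every block.
block-∖ : ∀ {α γ : Biword r} → Unique (top α) → All (Head γ) α → ∀ z → block z α ++ block z (γ ∖ α) ≡ block z γ
block-∖ {α = []} _ _ z = refl
block-∖ {α = (x , a) ∷ α} {γ} (h ∷ hs) (p ∷ ps) z = split (x Fin.≟ z)
  where
  ih : block z α ++ block z (remove (x , a) γ ∖ α) ≡ block z (remove (x , a) γ)
  ih = block-∖ hs (All.tabulate λ q → let ρ , e = All.lookup ps q in
    ρ , trans (block-remove-≢ (x , a) γ (All.lookup h (∈-map⁺ proj₁ q))) e) z
  split : Dec (x ≡ z) → block z ((x , a) ∷ α) ++ block z (remove (x , a) γ ∖ α) ≡ block z γ
  split (yes refl) = trans (cong (_++ block z (remove (x , a) γ ∖ α)) (block-accept x a α)) (trans (cong (_ ∷_) ih) (block-remove-Head γ p))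
  split (no x≢z)   = trans (cong (_++ block z (remove (x , a) γ ∖ α)) (block-reject a α x≢z)) (trans ih (block-remove-≢ (x , a) γ x≢z))

Unique⇒Head : ∀ {α : Biword r} → Unique (top α) → ∀ {p} → p ∈ α → Head α p
Unique⇒Head {α = (x , a) ∷ α} (h ∷ hs) (here refl) = _ , block-accept x a α
Unique⇒Head {α = (x , a) ∷ α} (h ∷ hs) (there p)   =
  let ρ , e = Unique⇒Head hs p in ρ , trans (block-reject a α (All.lookup h (∈-map⁺ proj₁ p))) e

-- Walk along heads from `x`. The circuit condition makes each bottom letter reached a top letter
-- again, so the walk never gets stuck and must eventually revisit a letter.
∃-cycle : ∀ {γ : Biword r} {x} → Circuit γ → x ∈ top γ →
  ∃₂ λ c v → Unique (v ++ [ c ]) × All (Head γ) (cycle c v)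
∃-cycle {r} {γ} {x} circ x∈ = search (suc r) x [] (ℕ.≤-reflexive (sym (ℕ.+-identityʳ _))) [] [] x∈
  where
  search : ∀ n a u → suc r ≤ n ℕ.+ length u → Unique u → All (Head γ) (edges a u) → a ∈ top γ →
    ∃₂ λ c v → Unique (v ++ [ c ]) × All (Head γ) (cycle c v)
  search zero    a u fuel uniq hs a∈ = contradiction (Unique-length uniq) (ℕ.<⇒≱ fuel)
  search (suc n) a u fuel uniq hs a∈ with any? (a Fin.≟_) u
  ... | no a∉u = let b , h = ∃-Head a∈ in
    search n b (a ∷ u) (subst (suc r ≤_) (sym (ℕ.+-suc n (length u))) fuel)
      (All.tabulate (λ { p refl → a∉u p }) ∷ uniq) (h ∷ hs)
      (∈-resp-↭ (↭-sym circ) (∈-map⁺ proj₂ (Head⇒∈ h)))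
  ... | yes a∈u with ∈-∃++ a∈u
  -- As `u` runs backwards, `w` is the part of the walk before the first visit to `a`; dropping it
  -- leaves the cycle.
  ...   | v , w , refl = a , v
    , AllPairs-++⁻ˡ (v ++ [ a ]) (subst Unique (sym (++-assoc v [ a ] w)) uniq)
    , All-edges-++⁻ˡ (v ++ [ a ]) (subst (All (Head γ) ∘ edges a) (sym (++-assoc v [ a ] w)) hs)

-- Toggling a cycle

insert : Biletter r → Biword r → Biword r
insert p []      = p ∷ []
insert p (q ∷ α) with proj₂ p Fin.<? proj₂ q
... | yes _ = p ∷ q ∷ α
... | no  _ = q ∷ insert p α

insertAll : Biword r → Biword r → Biword r
insertAll κ α = foldr insert α κ

insert-↭ : ∀ (p : Biletter r) α → insert p α ↭ p ∷ α
insert-↭ p []      = ↭-refl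
insert-↭ p (q ∷ α) with proj₂ p Fin.<? proj₂ q
... | yes _ = ↭-refl
... | no  _ = ↭-trans (prep q (insert-↭ p α)) (swap q p ↭-refl)

insertAll-↭ : ∀ (κ α : Biword r) → insertAll κ α ↭ κ ++ α
insertAll-↭ []      α = ↭-refl
insertAll-↭ (p ∷ κ) α = ↭-trans (insert-↭ p _) (prep p (insertAll-↭ κ α))

_<ᵇᵒᵗ_ : Rel (Biletter r) 0ℓ
_<ᵇᵒᵗ_ = Fin._<_ on proj₂

insert-increasing : ∀ (p : Biletter r) {α} → All (λ q → proj₂ p ≢ proj₂ q) α →
  AllPairs _<ᵇᵒᵗ_ α → AllPairs _<ᵇᵒᵗ_ (insert p α)
insert-increasing p []       []       = [] ∷ []
insert-increasing p {q ∷ α} (n ∷ ns) (h ∷ hs) with proj₂ p Fin.<? proj₂ q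
... | yes p<q = (p<q ∷ All.map (ℕ.<-trans p<q) h) ∷ h ∷ hs
... | no  p≮q = All-resp-↭ (↭-sym (insert-↭ p α)) (Fin.≤∧≢⇒< (ℕ.≮⇒≥ p≮q) (n ∘ sym) ∷ h) ∷ insert-increasing p ns hs

insertAll-increasing : ∀ (κ : Biword r) {α} → Unique (bottom (κ ++ α)) →
  AllPairs _<ᵇᵒᵗ_ α → AllPairs _<ᵇᵒᵗ_ (insertAll κ α)
insertAll-increasing []      u       h = h
insertAll-increasing (p ∷ κ) {α} (n ∷ u) h =
  insert-increasing p (All-resp-↭ (↭-sym (insertAll-↭ κ α)) (All.map⁻ n)) (insertAll-increasing κ u h)

increasing-↭⇒≡ : ∀ {α β : Biword r} → AllPairs _<ᵇᵒᵗ_ α → AllPairs _<ᵇᵒᵗ_ β → α ↭ β → α ≡ β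
increasing-↭⇒≡ = AllPairs-↭⇒≡ λ p q → contradiction q (ℕ.<-asym p)

-- The first factors of the factorisations of γ in Ferm × Bos, up to reduction.
record Admissible {r : ℕ} (γ α : Biword r) : Set where
  field
    increasing : AllPairs _<ᵇᵒᵗ_ α
    circuit    : Circuit α
    heads      : All (Head γ) α

  distinct : Distinct α
  distinct = Unique-resp-↭ (↭-sym circuit) unique , unique
    where unique = AllPairs.map⁺ (AllPairs.map Fin.<⇒≢ increasing)

  -- The biletter of α above which `x` stands is a head, hence the only candidate `(x , a)`; the
  -- circuit condition turns its bottom letter into a top letter. So `top α` is closed under the
  -- first-letter map.
  follow : ∀ {x a} → Head γ (x , a) → x ∈ top α → (x , a) ∈ α × a ∈ top α
  follow h x∈ with ∈-map⁻ proj₁ x∈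
  ... | p , p∈α , refl with refl ← Head-unique {γ = γ} h (All.lookup heads p∈α) =
    p∈α , ∈-resp-↭ (↭-sym circuit) (∈-map⁺ proj₂ p∈α)

  -- The start `z` of the path is the last letter listed, so the recursion reaches it first and then
  -- follows the arrows forward. One vertex of κ in α thus forces all of κ into α.
  followPath : ∀ {a z} u → All (Head γ) (edges a (u ++ [ z ])) → z ∈ top α →
    All (_∈ α) (edges a (u ++ [ z ])) × a ∈ top α
  followPath []      (h ∷ []) z∈ = let e∈ , a∈ = follow h z∈ in e∈ ∷ [] , a∈
  followPath (x ∷ u) (h ∷ hs) z∈ =
    let es∈ , x∈ = followPath u hs z∈
        e∈  , a∈ = follow h x∈
    in e∈ ∷ es∈ , a∈

module Toggle {r : ℕ} {γ : Biword r} {c : Fin r} {v : Word r} (κ-unique : Unique (v ++ [ c ])) (κ-heads : All (Head γ) (cycle c v)) where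
  open Admissible

  κ : Biword r
  κ = cycle c v

  top-κ-unique : Unique (top κ)
  top-κ-unique = subst Unique (sym (top-edges c (v ++ [ c ]))) κ-unique

  c∈top-κ : c ∈ top κ
  c∈top-κ = subst (c ∈_) (sym (top-edges c (v ++ [ c ]))) (∈-++⁺ʳ v (here refl))

  -- Testing `c` alone suffices: by `followPath` it decides for the whole cycle. Insertion by bottom
  -- letter returns to the order demanded by `Ferm`.
  toggle : Biword r → Biword r
  toggle α with any? (c Fin.≟_) (top α)
  ... | yes _ = α ∖ κ
  ... | no  _ = insertAll κ α

  toggle-∈ : ∀ {α} → c ∈ top α → toggle α ≡ α ∖ κ
  toggle-∈ {α} h with any? (c Fin.≟_) (top α)
  ... | yes _ = refl
  ... | no ¬h = contradiction h ¬h

  toggle-∉ : ∀ {α} → c ∉ top α → toggle α ≡ insertAll κ α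
  toggle-∉ {α} ¬h with any? (c Fin.≟_) (top α)
  ... | yes h = contradiction h ¬h
  ... | no _  = refl

  module _ {α : Biword r} (adm : Admissible γ α) (c∈α : c ∈ top α) where

    κ++∖ : κ ++ (α ∖ κ) ↭ α
    κ++∖ = ∖-↭ (Unique.map⁻ top-κ-unique) (proj₁ (followPath adm v κ-heads c∈α))

    ∖-admissible : Admissible γ (α ∖ κ)
    ∖-admissible = record
      { increasing = ∖-AllPairs κ (increasing adm)
      ; circuit    = ++-cancelˡ-↭ (top κ) (↭-trans split (++⁺ʳ _ (↭-sym (cycle-circuit c v))))
      ; heads      = ∖-All κ (heads adm)
      }
      where
      split : top κ ++ top (α ∖ κ) ↭ bottom κ ++ bottom (α ∖ κ)
      split = subst₂ _↭_ (map-++ proj₁ κ _) (map-++ proj₂ κ _)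
        (↭-trans (map-↭ proj₁ κ++∖) (↭-trans (circuit adm) (map-↭ proj₂ (↭-sym κ++∖))))

    c∉∖ : c ∉ top (α ∖ κ)
    c∉∖ h = Unique-++⇒Disjoint (top κ)
      (subst Unique (map-++ proj₁ κ _) (proj₁ (Distinct-resp-↭ (↭-sym κ++∖) (distinct adm)))) (c∈top-κ , h)

  module _ {α : Biword r} (adm : Admissible γ α) (c∉α : c ∉ top α) where

    -- From a shared letter the arrows of κ lead on to `c`, and closure of `top α` along them would
    -- put `c` into it.
    top-disjoint : Disjoint (top κ) (top α)
    top-disjoint (x∈κ , x∈α) with ∈-∃++ (subst (_ ∈_) (top-edges c (v ++ [ c ])) x∈κ)
    ... | u , w , e = c∉α (proj₂ (followPath adm u
      (All-edges-++⁻ˡ (u ++ [ _ ]) (subst (All (Head γ) ∘ edges c) (trans e (sym (++-assoc u [ _ ] w))) κ-heads)) x∈α))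

    κ++-circuit : Circuit (κ ++ α)
    κ++-circuit = subst₂ _↭_ (sym (map-++ proj₁ κ α)) (sym (map-++ proj₂ κ α)) (++⁺ (cycle-circuit c v) (circuit adm))

    κ++-unique : Unique (bottom (κ ++ α))
    κ++-unique = Unique-resp-↭ κ++-circuit
      (subst Unique (sym (map-++ proj₁ κ α)) (Unique.++⁺ top-κ-unique (proj₁ (distinct adm)) top-disjoint))

    insertAll-admissible : Admissible γ (insertAll κ α)
    insertAll-admissible = record
      { increasing = insertAll-increasing κ κ++-unique (increasing adm)
      ; circuit    = ↭-trans (map-↭ proj₁ (insertAll-↭ κ α)) (↭-trans κ++-circuit (map-↭ proj₂ (↭-sym (insertAll-↭ κ α))))
      ; heads      = All-resp-↭ (↭-sym (insertAll-↭ κ α)) (All.++⁺ κ-heads (heads adm))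
      }

    c∈insertAll : c ∈ top (insertAll κ α)
    c∈insertAll = ∈-resp-↭ (map-↭ proj₁ (↭-sym (insertAll-↭ κ α)))
      (subst (c ∈_) (sym (map-++ proj₁ κ α)) (∈-++⁺ˡ c∈top-κ))

  ε-κ++ : ∀ {α δ} → Admissible γ α → Admissible γ δ → κ ++ δ ↭ α → ε α ≡ - ε δ
  ε-κ++ {α} {δ} admα admδ p = begin
    ε α                ≡⟨ ε-↭ (distinct admα) (↭-sym p) ⟩
    ε (κ ++ δ)         ≡⟨ ε-++ κ δ (cycle-circuit c v) (circuit admδ) ⟩
    ε κ ℤ.* ε δ        ≡⟨ cong (ℤ._* ε δ) (ε-cycle c v κ-unique) ⟩
    (- + 1) ℤ.* ε δ    ≡⟨ ℤ.-1*i≡-i (ε δ) ⟩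
    - ε δ              ∎

  toggle-admissible : ∀ {α} → Admissible γ α → Admissible γ (toggle α)
  toggle-admissible {α} adm with any? (c Fin.≟_) (top α)
  ... | yes h = ∖-admissible adm h
  ... | no ¬h = insertAll-admissible adm ¬h

  toggle-ε : ∀ {α} → Admissible γ α → ε (toggle α) ≡ - ε α
  toggle-ε {α} adm with any? (c Fin.≟_) (top α)
  ... | yes h = trans (sym (ℤ.neg-involutive _)) (cong -_ (sym (ε-κ++ adm (∖-admissible adm h) (κ++∖ adm h))))
  ... | no ¬h = ε-κ++ (insertAll-admissible adm ¬h) adm (↭-sym (insertAll-↭ κ α))

  -- Removal and insertion undo each other up to permutation only; the increasing bottom words
  -- upgrade this to equality.
  toggle-involutive : ∀ {α} → Admissible γ α → toggle (toggle α) ≡ α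
  toggle-involutive {α} adm with any? (c Fin.≟_) (top α)
  ... | yes h = trans (toggle-∉ (c∉∖ adm h)) (increasing-↭⇒≡
    (increasing (insertAll-admissible (∖-admissible adm h) (c∉∖ adm h))) (increasing adm)
    (↭-trans (insertAll-↭ κ (α ∖ κ)) (κ++∖ adm h)))
  ... | no ¬h = trans (toggle-∈ c∈) (increasing-↭⇒≡ (increasing (∖-admissible adm' c∈)) (increasing adm)
    (++-cancelˡ-↭ κ (↭-trans (κ++∖ adm' c∈) (insertAll-↭ κ α))))
    where
    adm' = insertAll-admissible adm ¬h
    c∈   = c∈insertAll adm ¬h

-- Factorisations

module _ {r : ℕ} where
  open InsSort (Fin.≤-decTotalOrder r) using (sort-↭; sort-↗) public

sortW-sorted : ∀ (w : Word r) → AllPairs Fin._≤_ (sortW w)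
sortW-sorted w = Linked⇒AllPairs Fin.≤-trans (sort-↗ w)

sortW-unique : ∀ {u w : Word r} → u ↭ w → AllPairs Fin._≤_ w → sortW u ≡ w
sortW-unique {u = u} p h = AllPairs-↭⇒≡ Fin.≤-antisym (sortW-sorted u) h (↭-trans (sort-↭ u) p)

-- The tests made by `Ferm`, `Bos` and `reduceS`, gathered into one decidable condition outside
-- which a term is zero.
Valid : Biword r → Biword r × Biword r → Set
Valid γ (α , β) =
  AllPairs Fin._<_ (bottom α) × sortW (top α) ≡ bottom α × top β ≡ sortW (bottom β) × proj₂ (reduce (α ++ β)) ≡ γ

valid? : ∀ (γ : Biword r) x → Dec (Valid γ x)
valid? γ (α , β) =
  allPairs? Fin._<?_ (bottom α) ×-dec ≡-dec Fin._≟_ _ _ ×-dec ≡-dec Fin._≟_ _ _ ×-dec ≡-dec _≟B_ _ _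

module ValidProperties {r : ℕ} {γ α β : Biword r} (valid : Valid γ (α , β)) where

  normalises : Normalises (α ++ β) (proj₁ (reduce (α ++ β))) γ
  normalises = subst (Normalises (α ++ β) _) (proj₂ (proj₂ (proj₂ valid))) (reduce-normalises (α ++ β))

  open Normalises normalises public

  circuit-α : Circuit α
  circuit-α = subst (top α ↭_) (proj₁ (proj₂ valid)) (↭-sym (sort-↭ (top α)))

  circuit-β : Circuit β
  circuit-β = subst (_↭ bottom β) (sym (proj₁ (proj₂ (proj₂ valid)))) (sort-↭ (bottom β))

  topSorted-β : TopSorted β
  topSorted-β = subst (AllPairs Fin._≤_) (sym (proj₁ (proj₂ (proj₂ valid)))) (sortW-sorted (bottom β))

  circuit-γ : Circuit γ
  circuit-γ = ↭-trans (map-↭ proj₁ (↭-sym perm)) (↭-trans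
    (subst₂ _↭_ (sym (map-++ proj₁ α β)) (sym (map-++ proj₂ α β)) (++⁺ circuit-α circuit-β)) (map-↭ proj₂ perm))

  block-++ : ∀ z → block z α ++ block z β ≡ block z γ
  block-++ z = trans (sym (filter-++ (λ p → proj₁ p Fin.≟ z) α β)) (blocks z)

  -- In `α ++ β` the biletters of α precede those of β, and distinct top letters leave one per
  -- block, so each comes first in its block of γ.
  admissible : Admissible γ α
  admissible = record
    { increasing = AllPairs.map⁻ (proj₁ valid)
    ; circuit    = circuit-α
    ; heads      = All.tabulate λ {p} p∈ → let ρ , e = Unique⇒Head top-unique p∈ in
                     _ , trans (sym (block-++ (proj₁ p))) (cong (_++ block (proj₁ p) β) e)
    }
    where
    top-unique : Unique (top α)
    top-unique = Unique-resp-↭ (↭-sym circuit-α) (AllPairs.map Fin.<⇒≢ (proj₁ valid))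

  -- The rows `bottom α` and `top β` are sorted and contribute nothing, and the cross terms cancel.
  -- The surviving `inv (top α)` is what the negative power of q in `Ferm` compensates.
  exponent : proj₁ (reduce (α ++ β)) ℕ.+ inv (bottom β) ≡ inv (top α) ℕ.+ inv (bottom γ)
  exponent = ℕ.+-cancelʳ-≡ c _ _ (begin
    k ℕ.+ inv (bottom β) ℕ.+ c           ≡⟨ ℕ.+-assoc k _ c ⟩
    k ℕ.+ (inv (bottom β) ℕ.+ c)         ≡⟨ cong (k ℕ.+_) inv-bottom ⟨
    k ℕ.+ inv (bottom (α ++ β))          ≡⟨ weight ⟩
    inv (top (α ++ β)) ℕ.+ inv (bottom γ)    ≡⟨ cong (ℕ._+ inv (bottom γ)) inv-top ⟩
    inv (top α) ℕ.+ c ℕ.+ inv (bottom γ) ≡⟨ exchange (inv (top α)) c _ ⟩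
    inv (top α) ℕ.+ inv (bottom γ) ℕ.+ c ∎)
    where
    k = proj₁ (reduce (α ++ β))
    c = cross (top α) (top β)
    inv-bottom : inv (bottom (α ++ β)) ≡ inv (bottom β) ℕ.+ c
    inv-bottom = begin
      inv (bottom (α ++ β))                                                  ≡⟨ cong inv (map-++ proj₂ α β) ⟩
      inv (bottom α ++ bottom β)                                             ≡⟨ inv-++ (bottom α) (bottom β) ⟩
      inv (bottom α) ℕ.+ inv (bottom β) ℕ.+ cross (bottom α) (bottom β)      ≡⟨ cong₂ (λ m n → m ℕ.+ inv (bottom β) ℕ.+ n) (inv-sorted (AllPairs.map ℕ.<⇒≤ (proj₁ valid))) (sym (cross-↭ circuit-α circuit-β)) ⟩
      inv (bottom β) ℕ.+ c                                                   ∎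
    inv-top : inv (top (α ++ β)) ≡ inv (top α) ℕ.+ c
    inv-top = begin
      inv (top (α ++ β))                        ≡⟨ cong inv (map-++ proj₁ α β) ⟩
      inv (top α ++ top β)                      ≡⟨ inv-++ (top α) (top β) ⟩
      inv (top α) ℕ.+ inv (top β) ℕ.+ c         ≡⟨ cong (λ n → inv (top α) ℕ.+ n ℕ.+ c) (inv-sorted topSorted-β) ⟩
      inv (top α) ℕ.+ 0 ℕ.+ c                   ≡⟨ cong (ℕ._+ c) (ℕ.+-identityʳ _) ⟩
      inv (top α) ℕ.+ c                         ∎
    exchange : ∀ a b c → a ℕ.+ b ℕ.+ c ≡ a ℕ.+ c ℕ.+ b
    exchange = ℕSolver.solve-∀

valid-unique : ∀ {γ α β β' : Biword r} → Valid γ (α , β) → Valid γ (α , β') → β ≡ β'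
valid-unique {α = α} v v' = blocks-determine V.topSorted-β V'.topSorted-β
  λ z → ++-cancelˡ (block z α) _ _ (trans (V.block-++ z) (sym (V'.block-++ z)))
  where
  module V  = ValidProperties v
  module V' = ValidProperties v'

-- Converse of `admissible`: it supplies the second factor after a toggle. That the product reduces
-- to γ is read off from the blocks.
admissible⇒valid : ∀ {γ α : Biword r} → Circuit γ → TopSorted γ → Admissible γ α → Valid γ (α , γ ∖ α)
admissible⇒valid {γ = γ} {α} circ sorted adm =
    AllPairs.map⁺ increasing
  , sortW-unique circuit (AllPairs.map⁺ (AllPairs.map ℕ.<⇒≤ increasing))
  , sym (sortW-unique (↭-sym rest-circuit) rest-sorted)
  , blocks-determine N.topSorted sorted (λ z → trans (sym (N.blocks z))
      (trans (filter-++ (λ p → proj₁ p Fin.≟ z) α (γ ∖ α)) (block-∖ (proj₁ distinct) heads z)))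
  where
  open Admissible adm
  module N = Normalises (reduce-normalises (α ++ (γ ∖ α)))
  perm : α ++ (γ ∖ α) ↭ γ
  perm = ∖-↭ (Unique.map⁻ (proj₁ distinct)) (All.map (Head⇒∈ {γ = γ}) heads)
  rest-sorted : TopSorted (γ ∖ α)
  rest-sorted = AllPairs.map⁺ (∖-AllPairs α (AllPairs.map⁻ sorted))
  rest-circuit : Circuit (γ ∖ α)
  rest-circuit = ++-cancelˡ-↭ (top α) (↭-trans
    (subst₂ _↭_ (map-++ proj₁ α _) (map-++ proj₂ α _) (↭-trans (map-↭ proj₁ perm) (↭-trans circ (map-↭ proj₂ (↭-sym perm)))))
    (++⁺ʳ _ (↭-sym circuit)))

factorisations : ∀ r → ℕ → List (Biword r × Biword r)
factorisations r n = concatMap splits (allBiwords r n)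

splits-++ : ∀ (xs : List A) → All (λ (u , v) → u ++ v ≡ xs) (splits xs)
splits-++ []       = refl ∷ []
splits-++ (x ∷ xs) = refl ∷ All.map⁺ (All.map (cong (x ∷_)) (splits-++ xs))

∈-splits : ∀ (u v : List A) → (u , v) ∈ splits (u ++ v)
∈-splits []      []      = here refl
∈-splits []      (x ∷ v) = here refl
∈-splits (x ∷ u) v       = there (∈-map⁺ _ (∈-splits u v))

splits-unique : ∀ (xs : List A) → Unique (splits xs)
splits-unique []       = [] ∷ []
splits-unique (x ∷ xs) = All.map⁺ (All.tabulate λ _ ()) ∷ Unique.map⁺ (λ { refl → refl }) (splits-unique xs)

allBiwords-suc : ∀ r n → allBiwords r (suc n) ≡
  cartesianProductWith _∷_ (cartesianProduct (allFin r) (allFin r)) (allBiwords r n)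
allBiwords-suc r n = go (cartesianProduct (allFin r) (allFin r))
  where
  go : ∀ ps → concatMap (λ b → map (b ∷_) (allBiwords r n)) ps ≡ cartesianProductWith _∷_ ps (allBiwords r n)
  go []       = refl
  go (p ∷ ps) = cong (map (p ∷_) (allBiwords r n) ++_) (go ps)

allBiwords-unique : ∀ r n → Unique (allBiwords r n)
allBiwords-unique r zero    = [] ∷ []
allBiwords-unique r (suc n) = subst Unique (sym (allBiwords-suc r n))
  (Unique.cartesianProductWith⁺ _∷_ ∷-injective
    (Unique.cartesianProduct⁺ (Unique.allFin⁺ r) (Unique.allFin⁺ r)) (allBiwords-unique r n))

∈-allBiwords : ∀ (β : Biword r) → β ∈ allBiwords r (length β)
∈-allBiwords []            = here refl
∈-allBiwords {r} ((x , a) ∷ β) = subst (((x , a) ∷ β) ∈_) (sym (allBiwords-suc r (length β)))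
  (∈-cartesianProductWith⁺ _∷_ (∈-cartesianProduct⁺ (∈-allFin x) (∈-allFin a)) (∈-allBiwords β))

factorisations-unique : ∀ r n → Unique (factorisations r n)
factorisations-unique r n = Unique.concat⁺
  (All.map⁺ (All.tabulate λ {β} _ → splits-unique β))
  (AllPairs.map⁺ (AllPairs.map disjoint (allBiwords-unique r n)))
  where
  disjoint : ∀ {β β' : Biword r} → β ≢ β' → Disjoint (splits β) (splits β')
  disjoint β≢β' (p , q) = β≢β' (trans (sym (All.lookup (splits-++ _) p)) (All.lookup (splits-++ _) q))

∈-factorisations : ∀ (α β : Biword r) → (α , β) ∈ factorisations r (length (α ++ β))
∈-factorisations α β = ∈-concat⁺′ (∈-splits α β) (∈-map⁺ splits (∈-allBiwords (α ++ β)))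

-- Sums

sumℤ : List ℤ → ℤ
sumℤ = foldr ℤ._+_ (+ 0)

sumℤ-++ : ∀ xs ys → sumℤ (xs ++ ys) ≡ sumℤ xs ℤ.+ sumℤ ys
sumℤ-++ []       ys = sym (ℤ.+-identityˡ _)
sumℤ-++ (x ∷ xs) ys = trans (cong (ℤ._+_ x) (sumℤ-++ xs ys)) (sym (ℤ.+-assoc x _ _))

sumℤ-concatMap : ∀ {B : Set} (w : B → ℤ) (f : A → List B) xs →
  sumℤ (map w (concatMap f xs)) ≡ sumℤ (map (λ x → sumℤ (map w (f x))) xs)
sumℤ-concatMap w f []       = refl
sumℤ-concatMap w f (x ∷ xs) = trans (cong sumℤ (map-++ w (f x) _))
  (trans (sumℤ-++ (map w (f x)) _) (cong (ℤ._+_ (sumℤ (map w (f x)))) (sumℤ-concatMap w f xs)))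

sumℤ-neg : ∀ (w : A → ℤ) xs → sumℤ (map (-_ ∘ w) xs) ≡ - sumℤ (map w xs)
sumℤ-neg w []       = refl
sumℤ-neg w (x ∷ xs) = trans (cong (ℤ._+_ (- w x)) (sumℤ-neg w xs)) (sym (ℤ.neg-distrib-+ (w x) (sumℤ (map w xs))))

sumℤ-zero : ∀ (w : A → ℤ) {xs} → All (λ x → w x ≡ + 0) xs → sumℤ (map w xs) ≡ + 0
sumℤ-zero w []       = refl
sumℤ-zero w (h ∷ hs) = cong₂ ℤ._+_ h (sumℤ-zero w hs)

sumℤ-↭ : ∀ {xs ys} → xs ↭ ys → sumℤ xs ≡ sumℤ ys
sumℤ-↭ p = PermSetoid.foldr-commMonoid (setoid ℤ) ℤ.+-0-isCommutativeMonoid (↭⇒↭ₛ p)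

i≡-i⇒i≡0 : ∀ i → i ≡ - i → i ≡ + 0
i≡-i⇒i≡0 (+ zero) _ = refl

-- `φ` permutes the list, so the sum equals its own negative. Fixed points need no separate case,
-- since the sign rule already forces their weight to be zero.
sumℤ-involution : ∀ {xs : List A} (w : A → ℤ) (φ : A → A) → Unique xs → (∀ x → φ (φ x) ≡ x) →
  (∀ {x} → x ∈ xs → φ x ∈ xs) → (∀ x → w (φ x) ≡ - w x) → sumℤ (map w xs) ≡ + 0
sumℤ-involution {xs = xs} w φ uniq φφ φ∈ wφ = i≡-i⇒i≡0 _ (begin
  sumℤ (map w xs)          ≡⟨ sumℤ-↭ (map-↭ w φ-↭) ⟨
  sumℤ (map w (map φ xs))  ≡⟨ cong sumℤ (map-∘ xs) ⟨
  sumℤ (map (w ∘ φ) xs)    ≡⟨ cong sumℤ (map-cong wφ xs) ⟩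
  sumℤ (map (-_ ∘ w) xs)   ≡⟨ sumℤ-neg w xs ⟩
  - sumℤ (map w xs)        ∎)
  where
  φ-↭ : map φ xs ↭ xs
  φ-↭ = ∼bag⇒↭ (unique∧set⇒bag (Unique.map⁺ (λ {x} {y} e → trans (sym (φφ x)) (trans (cong φ e) (φφ y))) uniq) uniq
    (mk⇔ (λ p → let _ , q , e = ∈-map⁻ φ p in subst (_∈ xs) (sym e) (φ∈ q))
         (λ p → subst (_∈ map φ xs) (φφ _) (∈-map⁺ φ (φ∈ p)))))

-- Coefficients

coeff-++ : ∀ p p' i j → coeff (p +K p') i j ≡ coeff p i j ℤ.+ coeff p' i j
coeff-++ []                p' i j = sym (ℤ.+-identityˡ _)
coeff-++ ((c , a , b) ∷ p) p' i j = trans (cong (ℤ._+_ m) (coeff-++ p p' i j)) (sym (ℤ.+-assoc m (coeff p i j) (coeff p' i j)))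
  where m = if does (a ℤ.≟ i) ∧ does (b ℤ.≟ j) then c else + 0

coeff-sumK : ∀ ps i j → coeff (sumK ps) i j ≡ sumℤ (map (λ p → coeff p i j) ps)
coeff-sumK []       i j = refl
coeff-sumK (p ∷ ps) i j = trans (coeff-++ p (sumK ps) i j) (cong (ℤ._+_ (coeff p i j)) (coeff-sumK ps i j))

coeff-mono : ∀ c a b i j → coeff (mono c a b) i j ≡ c ℤ.* coeff (mono (+ 1) a b) i j
coeff-mono c a b i j with does (a ℤ.≟ i) ∧ does (b ℤ.≟ j)
... | true  = trans (ℤ.+-identityʳ c) (sym (ℤ.*-identityʳ c))
... | false = sym (ℤ.*-zeroʳ c)

mono-*K-++ : ∀ c a b p p' → mono c a b *K (p +K p') ≡ (mono c a b *K p) +K (mono c a b *K p')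
mono-*K-++ c a b p p' = trans (cong (_++ []) (map-++ _ p p')) (trans (++-identityʳ _)
  (sym (cong₂ _++_ (++-identityʳ (map _ p)) (++-identityʳ (map _ p')))))

mono-*K-sumK : ∀ c a b ps → mono c a b *K sumK ps ≡ sumK (map (mono c a b *K_) ps)
mono-*K-sumK c a b []       = refl
mono-*K-sumK c a b (p ∷ ps) = trans (mono-*K-++ c a b p (sumK ps)) (cong (_ +K_) (mono-*K-sumK c a b ps))

-- The contribution of one factorisation

term : Biword r → Biword r × Biword r → K
term γ (α , β) =
  if proj₂ (reduce (α ++ β)) ==B γ
  then mono (+ 1) (+ 0) (+ proj₁ (reduce (α ++ β))) *K (Ferm α *K Bos β)
  else 0K

-- Opposite terms do not cancel as lists of monomials in `K`; taking one coefficient moves the sum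
-- to integers, where they do.
coeff-reduceS : ∀ (γ : Biword r) i j → coeff (reduceS (Ferm ×S Bos) γ) i j ≡
  sumℤ (map (λ x → coeff (term γ x) i j) (factorisations r (length γ)))
coeff-reduceS {r} γ i j = begin
  coeff (reduceS (Ferm ×S Bos) γ) i j
    ≡⟨ coeff-sumK (map summand (allBiwords r (length γ))) i j ⟩
  sumℤ (map (λ p → coeff p i j) (map summand (allBiwords r (length γ))))
    ≡⟨ cong sumℤ (map-∘ (allBiwords r (length γ))) ⟨
  sumℤ (map (λ β → coeff (summand β) i j) (allBiwords r (length γ)))
    ≡⟨ cong sumℤ (map-cong expand (allBiwords r (length γ))) ⟩
  sumℤ (map (λ β → sumℤ (map (λ x → coeff (term γ x) i j) (splits β))) (allBiwords r (length γ)))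
    ≡⟨ sumℤ-concatMap (λ x → coeff (term γ x) i j) splits (allBiwords r (length γ)) ⟨
  sumℤ (map (λ x → coeff (term γ x) i j) (factorisations r (length γ))) ∎
  where
  scaled : Biword r → K → K
  scaled β p = if proj₂ (reduce β) ==B γ then mono (+ 1) (+ 0) (+ proj₁ (reduce β)) *K p else 0K

  summand : Biword r → K
  summand β = scaled β ((Ferm ×S Bos) β)

  scaled-sumK : ∀ β ps → coeff (scaled β (sumK ps)) i j ≡ sumℤ (map (λ p → coeff (scaled β p) i j) ps)
  scaled-sumK β ps with proj₂ (reduce β) ==B γ
  ... | false = sym (sumℤ-zero _ {ps} (All.tabulate λ _ → refl))
  ... | true  = trans (cong (λ p → coeff p i j) (mono-*K-sumK (+ 1) (+ 0) (+ k) ps))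
    (trans (coeff-sumK (map (mono (+ 1) (+ 0) (+ k) *K_) ps) i j) (cong sumℤ (sym (map-∘ ps))))
    where k = proj₁ (reduce β)

  expand : ∀ β → coeff (summand β) i j ≡ sumℤ (map (λ x → coeff (term γ x) i j) (splits β))
  expand β = trans (scaled-sumK β (map (λ (α , β) → Ferm α *K Bos β) (splits β))) (cong sumℤ (trans (sym (map-∘ (splits β)))
    (map-cong-local (All.map (λ { refl → refl }) (splits-++ β)))))

exc-++ : ∀ (α β : Biword r) → exc (α ++ β) ≡ exc α ℕ.+ exc β
exc-++ []            β = refl
exc-++ ((x , a) ∷ α) β = trans (cong (ℕ._+_ e) (exc-++ α β)) (sym (ℕ.+-assoc e _ _))
  where e = if does (x Fin.<? a) then 1 else 0

exc-↭ : ∀ {α β : Biword r} → α ↭ β → exc α ≡ exc β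
exc-↭ Perm.refl                     = refl
exc-↭ (prep _ p)                    = cong (ℕ._+_ _) (exc-↭ p)
exc-↭ (swap {ys = α} (x , a) (y , b) p) =
  trans (cong (λ n → e ℕ.+ (f ℕ.+ n)) (exc-↭ p)) (+-exchange e f (exc α))
  where
  e = if does (x Fin.<? a) then 1 else 0
  f = if does (y Fin.<? b) then 1 else 0
exc-↭ (Perm.trans p q)              = trans (exc-↭ p) (exc-↭ q)

-- The right side involves α only through its sign. The missing third factor of `ε α` is 1 because
-- the bottom word of α is increasing.
term-valid : ∀ (γ α β : Biword r) → Valid γ (α , β) →
  term γ (α , β) ≡ mono (ε α) (+ exc γ) (+ inv (bottom γ))
term-valid γ α β v@(p₁ , p₂ , p₃ , p₄)
  rewrite dec-true (≡-dec _≟B_ (proj₂ (reduce (α ++ β))) γ) p₄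
        | dec-true (allPairs? Fin._<?_ (bottom α)) p₁
        | dec-true (≡-dec Fin._≟_ (sortW (top α)) (bottom α)) p₂
        | dec-true (≡-dec Fin._≟_ (top β) (sortW (bottom β))) p₃ =
  cong₂ (λ c (a , b) → mono c a b) sign (cong₂ _,_ t-exponent q-exponent)
  where
  open ValidProperties v
  k = proj₁ (reduce (α ++ β))
  s = signℤ (length α ℕ.+ inv (top α))
  sign : + 1 ℤ.* (s ℤ.* + 1) ≡ ε α
  sign = begin
    + 1 ℤ.* (s ℤ.* + 1)                                          ≡⟨ trans (ℤ.*-identityˡ _) (ℤ.*-identityʳ s) ⟩
    s                                                            ≡⟨ signℤ-+ (length α) _ ⟩
    signℤ (length α) ℤ.* signℤ (inv (top α))                     ≡⟨ cong (signℤ (length α) ℤ.*_) (ℤ.*-identityʳ _) ⟨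
    signℤ (length α) ℤ.* (signℤ (inv (top α)) ℤ.* signℤ 0)       ≡⟨ cong (λ n → signℤ (length α) ℤ.* (signℤ (inv (top α)) ℤ.* signℤ n)) (inv-sorted (AllPairs.map ℕ.<⇒≤ p₁)) ⟨
    ε α                                                          ∎
  t-exponent : + 0 ℤ.+ (+ exc α ℤ.+ + exc β) ≡ + exc γ
  t-exponent = cong +_ (trans (sym (exc-++ α β)) (exc-↭ perm))
  q-exponent : + k ℤ.+ (- + inv (top α) ℤ.+ + inv (bottom β)) ≡ + inv (bottom γ)
  q-exponent = begin
    + k ℤ.+ (- + inv (top α) ℤ.+ + inv (bottom β))    ≡⟨ regroup (+ k) (+ inv (top α)) (+ inv (bottom β)) ⟩
    - + inv (top α) ℤ.+ + (k ℕ.+ inv (bottom β))      ≡⟨ cong (λ n → - + inv (top α) ℤ.+ + n) exponent ⟩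
    - + inv (top α) ℤ.+ (+ inv (top α) ℤ.+ + inv (bottom γ)) ≡⟨ cancel (+ inv (top α)) (+ inv (bottom γ)) ⟩
    + inv (bottom γ) ∎
    where
    regroup : ∀ a b c → a ℤ.+ (- b ℤ.+ c) ≡ - b ℤ.+ (a ℤ.+ c)
    regroup = ℤSolver.solve-∀
    cancel : ∀ a b → - a ℤ.+ (a ℤ.+ b) ≡ b
    cancel = ℤSolver.solve-∀

term-invalid : ∀ (γ α β : Biword r) → ¬ Valid γ (α , β) → term γ (α , β) ≡ 0K
term-invalid γ α β ¬v = vanish
  -- `does` of a product decision computes to a conjunction, so the failure of `valid?` becomes a
  -- Boolean equation on the four tests.
  (does (allPairs? Fin._<?_ (bottom α))) (does (≡-dec Fin._≟_ (sortW (top α)) (bottom α)))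
  (does (≡-dec Fin._≟_ (top β) (sortW (bottom β)))) (does (≡-dec _≟B_ (proj₂ (reduce (α ++ β))) γ))
  (dec-false (valid? γ (α , β)) ¬v)
  where
  vanish : ∀ b₁ b₂ b₃ b₄ {c' i' j' c″ i″ j″} → b₁ ∧ b₂ ∧ b₃ ∧ b₄ ≡ false →
    (if b₄ then mono (+ 1) (+ 0) (+ proj₁ (reduce (α ++ β))) *K ((if b₁ ∧ b₂ then mono c' i' j' else 0K) *K (if b₃ then mono c″ i″ j″ else 0K)) else 0K) ≡ 0K
  vanish b₁    b₂    b₃    false _ = refl
  vanish false b₂    b₃    true  _ = refl
  vanish true  false b₃    true  _ = refl
  vanish true  true  false true  _ = refl

coeff-term-valid : ∀ (γ α β : Biword r) → Valid γ (α , β) → ∀ i j →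
  coeff (term γ (α , β)) i j ≡ ε α ℤ.* coeff (mono (+ 1) (+ exc γ) (+ inv (bottom γ))) i j
coeff-term-valid γ α β v i j = trans (cong (λ p → coeff p i j) (term-valid γ α β v)) (coeff-mono (ε α) (+ exc γ) (+ inv (bottom γ)) i j)

-- Cancellation over the factorisations of a nonempty biword

factorisations-cancel : ∀ p (γ : Biword r) (i j : ℤ) → Circuit (p ∷ γ) → TopSorted (p ∷ γ) →
  sumℤ (map (λ x → coeff (term (p ∷ γ) x) i j) (factorisations r (length (p ∷ γ)))) ≡ + 0
factorisations-cancel {r} p γ₀ i j circ sorted with ∃-cycle {γ = p ∷ γ₀} circ (here refl)
... | c , v , uniq , heads = sumℤ-involution w φ (factorisations-unique r (length γ)) φφ φ∈ wφ
  where
  open Toggle {γ = p ∷ γ₀} uniq heads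
  γ = p ∷ γ₀

  w : Biword r × Biword r → ℤ
  w x = coeff (term γ x) i j

  -- Invalid pairs are fixed, harmlessly because their weight is zero. On valid pairs the second
  -- factor is recomputed from the new α, and `valid-unique` makes this return to the original β.
  φ : Biword r × Biword r → Biword r × Biword r
  φ x with valid? γ x
  ... | yes _ = toggle (proj₁ x) , γ ∖ toggle (proj₁ x)
  ... | no  _ = x

  φ-valid : ∀ {x} → Valid γ x → φ x ≡ (toggle (proj₁ x) , γ ∖ toggle (proj₁ x))
  φ-valid {x} vx with valid? γ x
  ... | yes _  = refl
  ... | no ¬vx = contradiction vx ¬vx

  toggled : ∀ {α β} → Valid γ (α , β) → Valid γ (toggle α , γ ∖ toggle α)
  toggled vx = admissible⇒valid circ sorted (toggle-admissible (ValidProperties.admissible vx))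

  φφ : ∀ x → φ (φ x) ≡ x
  φφ x@(α , β) = by-cases (valid? γ x)
    where
    by-cases : Dec (Valid γ x) → φ (φ x) ≡ x
    by-cases (yes vx) = begin
      φ (φ x)                                         ≡⟨ cong φ (φ-valid vx) ⟩
      φ (toggle α , γ ∖ toggle α)                     ≡⟨ φ-valid (toggled vx) ⟩
      (toggle (toggle α) , γ ∖ toggle (toggle α))     ≡⟨ cong (λ α' → α' , γ ∖ α') (toggle-involutive adm) ⟩
      (α , γ ∖ α)                                     ≡⟨ cong (α ,_) (valid-unique (admissible⇒valid circ sorted adm) vx) ⟩
      (α , β)                                         ∎
      where adm = ValidProperties.admissible vx
    by-cases (no ¬vx) = trans (cong φ fixed) fixed
      where
      fixed : φ x ≡ x
      fixed with valid? γ x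
      ... | yes vx = contradiction vx ¬vx
      ... | no _   = refl

  φ∈ : ∀ {x} → x ∈ factorisations r (length γ) → φ x ∈ factorisations r (length γ)
  φ∈ {x} x∈ with valid? γ x
  ... | no _   = x∈
  ... | yes vx = subst (λ n → (toggle (proj₁ x) , γ ∖ toggle (proj₁ x)) ∈ factorisations r n) (↭-length (ValidProperties.perm (toggled vx))) (∈-factorisations (toggle (proj₁ x)) (γ ∖ toggle (proj₁ x)))

  wφ : ∀ x → w (φ x) ≡ - w x
  wφ x@(α , β) with valid? γ x
  ... | no ¬vx rewrite term-invalid γ α β ¬vx = refl
  ... | yes vx = begin
    w (toggle α , γ ∖ toggle α)     ≡⟨ coeff-term-valid γ _ _ (toggled vx) i j ⟩
    ε (toggle α) ℤ.* m              ≡⟨ cong (ℤ._* m) (toggle-ε (ValidProperties.admissible vx)) ⟩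
    - ε α ℤ.* m                     ≡⟨ ℤ.neg-distribˡ-* (ε α) m ⟨
    - (ε α ℤ.* m)                   ≡⟨ cong -_ (coeff-term-valid γ α β vx i j) ⟨
    - w (α , β)                     ∎
    where m = coeff (mono (+ 1) (+ exc γ) (+ inv (bottom γ))) i j

mainTheorem2 : (r : ℕ) → 1 ≤ r → (γ : Biword r) →
    reduceS (Ferm ×S Bos) γ ≈K oneS γ
mainTheorem2 r _ []         i j = refl
mainTheorem2 r _ γ@(p ∷ γ₀) i j = trans (coeff-reduceS γ i j) (by-cases (any? (valid? γ) (factorisations r (length γ))))
  where
  -- Only a valid pair shows that γ is a circuit with sorted top word, as the cancellation requires;
  -- if there is none, every term vanishes.
  by-cases : Dec _ → sumℤ (map (λ x → coeff (term γ x) i j) (factorisations r (length γ))) ≡ + 0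
  by-cases (no none) = sumℤ-zero (λ x → coeff (term γ x) i j)
    (All.map (λ {x} ¬v → cong (λ p → coeff p i j) (term-invalid γ (proj₁ x) (proj₂ x) ¬v)) (All.¬Any⇒All¬ _ none))
  by-cases (yes some) with find some
  ... | (α , β) , _ , v = factorisations-cancel p γ₀ i j (ValidProperties.circuit-γ v) (ValidProperties.topSorted v)
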